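{- Let $n\ge 1$ be an integer, let $\Gamma=\mathrm{PSL}_2(\mathbb{Z})$, and let $\mathcal{M}_n$ be the set of $2\times 2$ integral matrices of determinant $n$ modulo $\pm 1$, on which $\Gamma$ acts by right multiplication. For a right coset $K\in\mathcal{M}_n/\Gamma$ let $\delta_K=\gcd(c,d)$, where $\begin{pmatrix} a&b\\ c&d\end{pmatrix}$ is any representative of $K$, and let $\delta_K'=n/\delta_K$. Then for each right coset $K\in\mathcal{M}_n/\Gamma$, \[ \sum_{\substack{M\in K\\ M\text{ elliptic}}}\chi(z_M)\;=\;1+\operatorname{sgn}(\delta_K'-\delta_K)+\begin{cases}1/6 & \text{if } K=\sqrt{n}\,\Gamma,\\ 0&\text{otherwise.}\end{cases} \]
   Context: A matrix $M\in\mathcal{M}_n$ is called elliptic if $(\operatorname{tr} M)^2<4\det M$; then $M$ (acting by Möbius transformations) has a unique fixed point $z_M$ in the upper half-plane $\mathfrak{H}=\{z\in\mathbb{C}:\operatorname{Im} z>0\}$. The coset $\sqrt{n}\,\Gamma$ (which exists only when $n$ is a perfect square) is the coset of the scalar matrix $\sqrt{n}\,I$. Let $\mathcal{F}=\{z\in\mathfrak{H}:-1/2\le \operatorname{Re} z\le 1/2,\ |z|\ge 1\}$ be the standard fundamental domain. The function $\chi:\mathfrak{H}\to\mathbb{Q}$ is defined by $\chi(z)=\frac{1}{2\pi}\times$(the angle subtended by $\mathcal{F}$ at $z$), i.e. the limiting fraction of a small disc around $z$ lying in $\mathcal{F}$: thus $\chi=1$ in the interior of $\mathcal{F}$, $0$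 outside $\mathcal{F}$, $1/2$ at boundary points of $\mathcal{F}$ other than the corners $\rho=e^{\pi i/3}$ and $\rho^2$, and $1/6$ at $\rho$ and $\rho^2$. -}

module Defs where

open import Data.Nat as ℕ using (ℕ; suc; _<ᵇ_)
open import Data.Nat.GCD using (gcd)
open import Data.Integer as ℤ using (ℤ; +_; -[1+_]; ∣_∣)
open import Data.Rational as ℚ using (ℚ; 0ℚ; 1ℚ; ½; _/_)
open import Data.Rational.Properties using (_<?_; _≟_)
open import Data.Bool using (if_then_else_)
open import Data.Product using (Σ; _×_)
open import Data.Sum using (_⊎_)
open import Data.List using (List; foldr)
open import Relation.Nullary using (does)
open import Relation.Binary.PropositionalEquality using (_≡_)

record Mat : Set where
  constructor mat
  field
    a b c d : ℤ
open Mat public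

det : Mat → ℤ
det M = a M ℤ.* d M ℤ.- b M ℤ.* c M

tr : Mat → ℤ
tr M = a M ℤ.+ d M

_·_ : Mat → Mat → Mat
mat a₁ b₁ c₁ d₁ · mat a₂ b₂ c₂ d₂ =
  mat (a₁ ℤ.* a₂ ℤ.+ b₁ ℤ.* c₂) (a₁ ℤ.* b₂ ℤ.+ b₁ ℤ.* d₂)
      (c₁ ℤ.* a₂ ℤ.+ d₁ ℤ.* c₂) (c₁ ℤ.* b₂ ℤ.+ d₁ ℤ.* d₂)

negM : Mat → Mat
negM (mat a b c d) = mat (ℤ.- a) (ℤ.- b) (ℤ.- c) (ℤ.- d)

scalar : ℤ → Mat
scalar s = mat s (+ 0) (+ 0) s

_≈±_ : Mat → Mat → Set
M ≈± N = (M ≡ N) ⊎ (M ≡ negM N)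

-- M lies in the right coset K = M₀Γ (Γ = PSL₂(ℤ); the sign is absorbed since -I ∈ SL₂(ℤ))
InCoset : Mat → Mat → Set
InCoset M₀ M = Σ Mat (λ γ → (det γ ≡ + 1) × (M₀ · γ ≡ M))

Elliptic : Mat → Set
Elliptic M = tr M ℤ.* tr M ℤ.< + 4 ℤ.* det M

-- A point x + i y of the upper half plane with rational x and rational y²
-- is encoded as the pair (x , y²).
-- Fixed point in 𝔥 of an elliptic M = (a b; c d) (for which c ≠ 0):
--   z_M = (a - d)/(2c) + i · sqrt(4 det M - (tr M)²) / (2|c|).
-- (For c = 0 the matrix is never elliptic; a junk value is returned.)
fixPt : Mat → ℚ × ℚ
fixPt M with c M
... | + 0 = Data.Product._,_ 0ℚ 0ℚ
... | + (suc k) = Data.Product._,_ ((a M ℤ.- d M) / (2 ℕ.* suc k))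
                                   ((+ 4 ℤ.* det M ℤ.- tr M ℤ.* tr M) / (4 ℕ.* (suc k ℕ.* suc k)))
... | -[1+ k ] = Data.Product._,_ ((d M ℤ.- a M) / (2 ℕ.* suc k))
                                  ((+ 4 ℤ.* det M ℤ.- tr M ℤ.* tr M) / (4 ℕ.* (suc k ℕ.* suc k)))

sixth : ℚ
sixth = + 1 / 6

-- χ at the point x + i y (given as (x , y²), y > 0):
-- fraction of a small disc around z lying in 𝓕 = {|Re z| ≤ 1/2, |z| ≥ 1}.
χ : ℚ × ℚ → ℚ
χ (Data.Product._,_ x y²) =
  let ax = ℚ.∣ x ∣
      r² = x ℚ.* x ℚ.+ y²
  in if does (ax <? ½) then
       (if does (1ℚ <? r²) then 1ℚ
        else if does (r² ≟ 1ℚ) then ½ else 0ℚ)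
     else if does (ax ≟ ½) then
       (if does (1ℚ <? r²) then ½
        else if does (r² ≟ 1ℚ) then sixth else 0ℚ)
     else 0ℚ

χM : Mat → ℚ
χM M = χ (fixPt M)

sumℚ : List ℚ → ℚ
sumℚ = foldr ℚ._+_ 0ℚ

δ : Mat → ℕ
δ M = gcd ∣ c M ∣ ∣ d M ∣

sgnDiff : ℕ → ℕ → ℚ
sgnDiff x y = if x <ᵇ y then ℚ.- 1ℚ else if y <ᵇ x then 1ℚ else 0ℚ

IsRootCoset : ℕ → Mat → Set
IsRootCoset n M₀ = Σ ℕ (λ s → (s ℕ.* s ≡ n) × InCoset (scalar (+ s)) M₀)

{-# OPTIONS --safe #-}
-- A coset K = M₀Γ is the set of oriented bases (v₁ , v₂), up to sign, of the lattice Λ = M₀ℤ²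
-- (v₁ , v₂ are the columns).  If M is normalised to have c > 0, then z_M ∈ 𝓕 means |a - d| ≤ c ≤ -b.
-- Up to one of three fixed right multiplications, every such M is a basis of Λ with v₁ = (a , c) in
-- the quadrant x > 0, y ≥ 0 and v₂ = (-b , d) in the quadrant x ≤ 0, y > 0; then a, b, c, d are natural
-- numbers (a "state").  All these bases lie on one chain, along which the subtractive Euclidean
-- algorithm acts on (a , b) while c and d grow, and which starts at the Hermite normal form
-- (δ' , b , 0 , δ) of K.  On this chain the weights χ telescope: the weight of a state is the drop of a
-- potential determined by comparing a with d, b with c, and |a - d|, |b - c| with c, d.  The potential
-- is eventually 0, and its initial value is governed by how δ' compares with δ.
module Submission where

-- The boundary values of `χ` are exactly what an exact telescoping needs. When the fixed point of
-- one matrix leaves the domain, that of another enters it; at the tie two of them lie on edges (3 +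
-- 3 = 6 sixths) or three of them at corners (1 + 1 + 1 = 3 sixths). The three multiplications come
-- from the signs of the diagonal entries: both positive, neither positive, or mixed. The mixed case
-- has two forms, chosen by the same comparison of a with b that directs the Euclidean step. Hence a
-- matrix determines its state, and nothing is counted twice. The obstacle is the end c = 0. There
-- the chain continues backwards for ever and the telescoping identity can fail. So the two states
-- with c = 0 that can carry weight are evaluated separately, and the potential takes over from the
-- first state with c > 0. The totals are 0, 6 or 12 sixths according to whether δ' is less than,
-- equal to or greater than δ, with 7 in place of 6 for the root coset.

-- Weights in sixths and the identity by which they telescope.

module Weights where
  open import Data.Nat
  open import Data.Nat.Properties
  open import Data.Nat.Tactic.RingSolver using (solve)
  open import Data.List using ([]; _∷_)
  open import Data.Sum using (_⊎_; inj₁; inj₂; [_,_]′)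
  open import Function using (id)
  open import Relation.Binary.Definitions using (tri<; tri≈; tri>)
  open import Relation.Binary.PropositionalEquality

  data Ord : Set where
    lt eq gt : Ord

  cmp : ℕ → ℕ → Ord
  cmp zero zero = eq
  cmp zero (suc _) = lt
  cmp (suc _) zero = gt
  cmp (suc m) (suc n) = cmp m n

  cmp-< : ∀ {m n} → m < n → cmp m n ≡ lt
  cmp-< {zero} (s≤s _) = refl
  cmp-< {suc m} (s≤s p) = cmp-< p

  cmp-> : ∀ {m n} → n < m → cmp m n ≡ gt
  cmp-> {n = zero} (s≤s _) = refl
  cmp-> {n = suc n} (s≤s p) = cmp-> p

  cmp-≡ : ∀ {m n} → m ≡ n → cmp m n ≡ eq
  cmp-≡ {zero} refl = refl
  cmp-≡ {suc m} refl = cmp-≡ {m} refl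

  -- Indexed by the comparisons of a with d + c, of d with a + c, and of c with b.
  weightTable : Ord → Ord → Ord → ℕ
  weightTable lt lt lt = 6
  weightTable lt lt eq = 3
  weightTable eq lt lt = 3
  weightTable lt eq lt = 3
  weightTable eq lt eq = 1
  weightTable lt eq eq = 1
  weightTable _  _  _  = 0

  -- Six times χ at the fixed point of a matrix (α -b; c δ) with α - δ = a - d; it is 0 when c = 0.
  weight : ℕ → ℕ → ℕ → ℕ → ℕ
  weight a d c b = weightTable (cmp a (d + c)) (cmp d (a + c)) (cmp c b)

  -- Linear arithmetic by certificate: p ≤ q is a sum of hypotheses, k the slack.
  lin : ∀ {x y p q} k → p ≤ q → y + p ≡ (x + q) + k → x ≤ y
  lin {x} {y} {p} {q} k p≤q e = +-cancelʳ-≤ q x y (begin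
    x + q         ≤⟨ m≤m+n (x + q) k ⟩
    x + q + k     ≡⟨ e ⟨
    y + p         ≤⟨ +-monoʳ-≤ y p≤q ⟩
    y + q         ∎)
    where open ≤-Reasoning

  _⊕_ : ∀ {p q r s} → p ≤ q → r ≤ s → p + r ≤ q + s
  _⊕_ = +-mono-≤
  infixl 6 _⊕_

  weightTable-gt₃ : ∀ o o' → weightTable o o' gt ≡ 0
  weightTable-gt₃ lt lt = refl
  weightTable-gt₃ lt eq = refl
  weightTable-gt₃ lt gt = refl
  weightTable-gt₃ eq lt = refl
  weightTable-gt₃ eq eq = refl
  weightTable-gt₃ eq gt = refl
  weightTable-gt₃ gt lt = refl
  weightTable-gt₃ gt eq = refl
  weightTable-gt₃ gt gt = refl

  weightTable-comm : ∀ o o' o'' → weightTable o o' o'' ≡ weightTable o' o o''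
  weightTable-comm lt lt _ = refl
  weightTable-comm lt eq lt = refl
  weightTable-comm lt eq eq = refl
  weightTable-comm lt eq gt = refl
  weightTable-comm lt gt lt = refl
  weightTable-comm lt gt eq = refl
  weightTable-comm lt gt gt = refl
  weightTable-comm eq lt lt = refl
  weightTable-comm eq lt eq = refl
  weightTable-comm eq lt gt = refl
  weightTable-comm eq eq _ = refl
  weightTable-comm eq gt lt = refl
  weightTable-comm eq gt eq = refl
  weightTable-comm eq gt gt = refl
  weightTable-comm gt lt lt = refl
  weightTable-comm gt lt eq = refl
  weightTable-comm gt lt gt = refl
  weightTable-comm gt eq lt = refl
  weightTable-comm gt eq eq = refl
  weightTable-comm gt eq gt = refl
  weightTable-comm gt gt _ = refl

  weight-comm : ∀ a d c b → weight a d c b ≡ weight d a c b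
  weight-comm a d c b = weightTable-comm (cmp a (d + c)) (cmp d (a + c)) (cmp c b)

  weight-interior : ∀ {a d c b} → a < d + c → d < a + c → c < b → weight a d c b ≡ 6
  weight-interior p q r rewrite cmp-< p | cmp-< q | cmp-< r = refl

  weight-arc : ∀ {a d c b} → a < d + c → d < a + c → c ≡ b → weight a d c b ≡ 3
  weight-arc {c = c} p q r rewrite cmp-< p | cmp-< q | cmp-≡ r = refl

  d<d+c+c : ∀ {c} d → 0 < c → d < (d + c) + c
  d<d+c+c {c} d h = lin c h (solve (c ∷ d ∷ []))

  weight-side : ∀ {a d c b} → a ≡ d + c → 0 < c → c < b → weight a d c b ≡ 3
  weight-side {d = d} {c} refl h r rewrite cmp-≡ {d + c} refl | cmp-< (d<d+c+c d h) | cmp-< r = refl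

  weight-corner : ∀ {a d c b} → a ≡ d + c → 0 < c → c ≡ b → weight a d c b ≡ 1
  weight-corner {d = d} {c} refl h refl
    rewrite cmp-≡ {d + c} refl | cmp-< (d<d+c+c d h) | cmp-≡ {c} refl = refl

  weight-below : ∀ {a d c b} → b < c → weight a d c b ≡ 0
  weight-below {a} {d} {c} p rewrite cmp-> p = weightTable-gt₃ (cmp a (d + c)) (cmp d (a + c))

  weight-outside : ∀ {a d c b} → d + c < a → weight a d c b ≡ 0
  weight-outside {a} {d} {c} {b} p rewrite cmp-> p = refl

  -- The unit is a sixth of a fixed point: 6 is a point in the interior, 3 the average of inside and
  -- outside at a tie.
  half : Ord → ℕ
  half lt = 0
  half eq = 3
  half gt = 6

  -- For c , d > 0 this is the total weight of the state (a , b , c , d) and of all its successors.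
  potential : ℕ → ℕ → ℕ → ℕ → ℕ
  potential a b c d with cmp a d | cmp b c
  ... | lt | _  = weight a d c b
  ... | _  | lt = weight b c d a
  ... | o  | o' = half o + half o'

  potential-a<d : ∀ {a b c d} → a < d → potential a b c d ≡ weight a d c b
  potential-a<d p rewrite cmp-< p = refl

  potential-b<c : ∀ {a b c d} → d ≤ a → b < c → potential a b c d ≡ weight b c d a
  potential-b<c {a} {b} {c} {d} p q with m≤n⇒m<n∨m≡n p
  ... | inj₁ r rewrite cmp-> r | cmp-< q = refl
  ... | inj₂ r rewrite cmp-≡ (sym r) | cmp-< q = refl

  potential-high : ∀ {a b c d} → d ≤ a → c ≤ b →
    potential a b c d ≡ half (cmp a d) + half (cmp b c)
  potential-high {a} {b} {c} {d} p q with m≤n⇒m<n∨m≡n p | m≤n⇒m<n∨m≡n q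
  ... | inj₁ r | inj₁ s rewrite cmp-> r | cmp-> s = refl
  ... | inj₁ r | inj₂ s rewrite cmp-> r | cmp-≡ (sym s) = refl
  ... | inj₂ r | inj₁ s rewrite cmp-≡ (sym r) | cmp-> s = refl
  ... | inj₂ r | inj₂ s rewrite cmp-≡ (sym r) | cmp-≡ (sym s) = refl

  -- The reflection of the plane in the vertical axis exchanges the two quadrants and so the two
  -- basis vectors. By this symmetry only one of the two Euclidean steps has to be analysed.
  potential-swap : ∀ a b c d → potential a b c d ≡ potential b a d c
  potential-swap a b c d with <-≤-connex a d | <-≤-connex b c
  ... | inj₁ p | inj₁ q = trans (potential-a<d p) (trans (weight-below {a} {d} {c} {b} q) (sym (trans (potential-a<d q) (weight-below {b} {c} {d} {a} p))))
  ... | inj₁ p | inj₂ q = trans (potential-a<d p) (sym (potential-b<c q p))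
  ... | inj₂ p | inj₁ q = trans (potential-b<c p q) (sym (potential-a<d q))
  ... | inj₂ p | inj₂ q = trans (potential-high p q) (trans (+-comm (half (cmp a d)) _) (sym (potential-high q p)))

  -- The weights of the three matrices attached to the state (e + b , b , c , d).
  stepWeight : ℕ → ℕ → ℕ → ℕ → ℕ
  stepWeight e b c d =
    weight (e + b) d c b + weight b c d (e + b) + weight (e + b + c) b (c + d) (e + b)

  -- Only the basis matrix can have weight here: the fixed points of the other two, and the one that
  -- gives the next potential, lie below the unit circle. The argument also covers `c = 0`, where
  -- `startWeight-<` uses it.
  step-a<d : ∀ {e b c d} → e + b < d → potential (e + b) b c d ≡ stepWeight e b c d + potential e b (c + d) d
  step-a<d {e} {b} {c} {d} p = trans (potential-a<d p) (sym (begin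
    weight (e + b) d c b + weight b c d (e + b) + weight (e + b + c) b (c + d) (e + b) + potential e b (c + d) d
      ≡⟨ cong₂ _+_ (cong₂ _+_ (cong (weight (e + b) d c b +_) (weight-below {b} {c} {d} {e + b} p))
          (weight-below {e + b + c} {b} {c + d} {e + b} (lin c p (solve (e ∷ b ∷ c ∷ d ∷ [])))))
          (trans (potential-a<d {e} {b} {c + d} {d} (lin b p (solve (e ∷ b ∷ d ∷ [])))) (weight-below {e} {d} {c + d} {b} (lin (e + c) p (solve (e ∷ b ∷ c ∷ d ∷ []))))) ⟩
    weight (e + b) d c b + 0 + 0 + 0
      ≡⟨ trans (+-identityʳ _) (trans (+-identityʳ _) (+-identityʳ _)) ⟩
    weight (e + b) d c b ∎))
    where open ≡-Reasoning

  -- Only the rotated matrix can have weight. The diagonal matrix is excluded by the strip if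
  -- `d < e` and by the circle otherwise; the next potential is excluded by the circle if `e < d`
  -- and by the strip otherwise.
  step-b<c : ∀ {e b c d} → d ≤ e + b → b < c → potential (e + b) b c d ≡ stepWeight e b c d + potential e b (c + d) d
  step-b<c {e} {b} {c} {d} p q = trans (potential-b<c p q) (sym (begin
    weight (e + b) d c b + weight b c d (e + b) + weight (e + b + c) b (c + d) (e + b) + potential e b (c + d) d
      ≡⟨ cong₂ _+_ (cong₂ _+_ (cong (_+ weight b c d (e + b)) (weight-below {e + b} {d} q)) X≡0) Ψ≡0 ⟩
    weight b c d (e + b) + 0 + 0
      ≡⟨ trans (+-identityʳ _) (+-identityʳ _) ⟩
    weight b c d (e + b) ∎))
    where
    open ≡-Reasoning
    b<c+d : b < c + d
    b<c+d = lin d q (solve (b ∷ c ∷ d ∷ []))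
    X≡0 : weight (e + b + c) b (c + d) (e + b) ≡ 0
    X≡0 with <-≤-connex d e
    ... | inj₁ r = weight-outside {e + b + c} {b} {c + d} {e + b} (lin 0 r (solve (e ∷ b ∷ c ∷ d ∷ [])))
    ... | inj₂ r = weight-below {e + b + c} {b} {c + d} {e + b} (lin 0 (q ⊕ r) (solve (e ∷ b ∷ c ∷ d ∷ [])))
    Ψ≡0 : potential e b (c + d) d ≡ 0
    Ψ≡0 with <-≤-connex e d
    ... | inj₁ r = trans (potential-a<d {e} {b} r) (weight-below {e} {d} b<c+d)
    ... | inj₂ r = trans (potential-b<c {e} {b} r b<c+d) (trans (weight-comm b (c + d) d e)
                     (weight-outside {c + d} {b} {d} {e} (lin 0 q (solve (b ∷ c ∷ d ∷ [])))))

  -- The comparisons of `e` with `d` and of `b` with `c + d` decide what the next potential is, and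
  -- in each case the three weights make up the difference. The positivity hypotheses are stated so
  -- as to admit `c = 0` when `d < e + b`, which `startWeight->⁺` relies on.
  step-high : ∀ {e b c d} → d ≤ e + b → c ≤ b → 0 < d → 0 < b → 0 < e + c → 0 < c ⊎ d < e + b →
    potential (e + b) b c d ≡ stepWeight e b c d + potential e b (c + d) d
  step-high {e} {b} {c} {d} d≤a c≤b d>0 b>0 ec>0 c>0⊎d<a =
    trans (potential-high d≤a c≤b) (sym main)
    where
    VΨ = stepWeight e b c d + potential e b (c + d) d
    main : VΨ ≡ half (cmp (e + b) d) + half (cmp b c)
    main with <-≤-connex e d | <-≤-connex b (c + d)
    -- The next potential is a single weight, so four weights have to add up to two halves; paired
    -- suitably, each pair gives one half.
    ... | inj₁ e<d | _ = begin
        VΨ  ≡⟨ cong (stepWeight e b c d +_) (potential-a<d {e} {b} e<d) ⟩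
        weight (e + b) d c b + weight b c d (e + b) + weight (e + b + c) b (c + d) (e + b) + weight e d (c + d) b
            ≡⟨ regroup (weight (e + b) d c b) _ _ _ ⟩
        (weight b c d (e + b) + weight e d (c + d) b) + (weight (e + b) d c b + weight (e + b + c) b (c + d) (e + b))
            ≡⟨ cong₂ _+_ one two ⟩
        half (cmp (e + b) d) + half (cmp b c) ∎
      where
      open ≡-Reasoning
      regroup : ∀ x y z u → x + y + z + u ≡ (y + u) + (x + z)
      regroup x y z u = solve (x ∷ y ∷ z ∷ u ∷ [])
      d<a : c + d ≤ b → d < (e + b)
      d<a p = lin 0 (ec>0 ⊕ p) (solve (c ∷ d ∷ e ∷ b ∷ []))
      -- As `b` grows past `c + d`, the rotated matrix leaves the strip just when the next basis
      -- matrix rises above the circle. At `b = c + d` the first is on a side and the second on the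
      -- arc.
      one : weight b c d (e + b) + weight e d (c + d) b ≡ half (cmp (e + b) d)
      one with <-cmp b (c + d)
      ... | tri< p _ _ rewrite weight-below {e} {d} p with m≤n⇒m<n∨m≡n d≤a
      ...   | inj₁ q rewrite weight-interior {b} {c} {d} {e + b} p (lin 0 (c≤b ⊕ d>0) (solve (b ∷ c ∷ d ∷ []))) q | cmp-> q = refl
      ...   | inj₂ q rewrite weight-arc {b} {c} {d} {e + b} p (lin 0 (c≤b ⊕ d>0) (solve (b ∷ c ∷ d ∷ []))) q | cmp-≡ (sym q) = refl
      one | tri≈ _ p _
        rewrite weight-side {b} {c} {d} {e + b} p d>0 (d<a (≤-reflexive (sym p))) | cmp-> (d<a (≤-reflexive (sym p)))
              | weight-arc {e} {d} {c + d} {b} (lin (c + d) e<d (solve (c ∷ d ∷ e ∷ []))) (lin 0 ec>0 (solve (c ∷ d ∷ e ∷ []))) (sym p) = refl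
      one | tri> _ _ p
        rewrite weight-outside {b} {c} {d} {e + b} p | cmp-> (d<a (<⇒≤ p))
              | weight-interior {e} {d} {c + d} {b} (lin (c + d) e<d (solve (c ∷ d ∷ e ∷ []))) (lin 0 ec>0 (solve (c ∷ d ∷ e ∷ []))) p = refl
      X₁ : e + b + c < b + (c + d)
      X₁ = lin 0 e<d (solve (c ∷ d ∷ e ∷ b ∷ []))
      X₂ : b < e + b + c + (c + d)
      X₂ = lin (e + c + c) d>0 (solve (c ∷ d ∷ e ∷ b ∷ []))
      c>0 : (e + b) ≡ c + d → 0 < c
      c>0 p = [ id , from-d<a ]′ c>0⊎d<a
        where
        from-d<a : d < e + b → 0 < c
        from-d<a h = lin 0 (h ⊕ ≤-reflexive p) (solve (c ∷ d ∷ e ∷ b ∷ []))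
      c<b : c + d ≤ (e + b) → c < b
      c<b p = lin 0 (e<d ⊕ p) (solve (c ∷ d ∷ e ∷ b ∷ []))
      -- The same exchange, between the basis matrix leaving the strip and the diagonal matrix
      -- rising above the circle, as `e + b` passes `c + d`.
      two : weight (e + b) d c b + weight (e + b + c) b (c + d) (e + b) ≡ half (cmp b c)
      two with <-cmp (e + b) (c + d)
      ... | tri< p _ _ rewrite weight-below {e + b + c} {b} p with m≤n⇒m<n∨m≡n c≤b
      ...   | inj₁ q rewrite weight-interior {e + b} {d} {c} {b} (subst ((e + b) <_) (+-comm c d) p) (lin 0 (p ⊕ d≤a ⊕ d≤a) (solve (c ∷ d ∷ e ∷ b ∷ []))) q | cmp-> q = refl
      ...   | inj₂ q rewrite weight-arc {e + b} {d} {c} {b} (subst ((e + b) <_) (+-comm c d) p) (lin 0 (p ⊕ d≤a ⊕ d≤a) (solve (c ∷ d ∷ e ∷ b ∷ []))) q | cmp-≡ (sym q) = refl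
      two | tri≈ _ p _
        rewrite weight-side {e + b} {d} {c} {b} (trans p (+-comm c d)) (c>0 p) (c<b (≤-reflexive (sym p))) | cmp-> (c<b (≤-reflexive (sym p)))
              | weight-arc {e + b + c} {b} {c + d} {e + b} X₁ X₂ (sym p) = refl
      two | tri> _ _ p
        rewrite weight-outside {e + b} {d} {c} {b} (subst (_< (e + b)) (+-comm c d) p) | cmp-> (c<b (<⇒≤ p))
              | weight-interior {e + b + c} {b} {c + d} {e + b} X₁ X₂ p = refl
    -- The rotated matrix is interior and pays for the half 6 coming from `d < e + b`; the other
    -- three weights have to give the half of `cmp b c`.
    ... | inj₂ d≤e | inj₁ b<c+d = trans (cong (stepWeight e b c d +_) (potential-b<c d≤e b<c+d)) sub
      where
      d<a : d < (e + b)
      d<a = lin 0 (d≤e ⊕ b>0) (solve (d ∷ e ∷ b ∷ []))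
      W₂ : weight b c d (e + b) ≡ 6
      W₂ = weight-interior {b} {c} {d} {e + b} b<c+d (lin 0 (c≤b ⊕ d>0) (solve (b ∷ c ∷ d ∷ []))) d<a
      sub : stepWeight e b c d + weight b (c + d) d e ≡ half (cmp (e + b) d) + half (cmp b c)
      sub rewrite cmp-> d<a | W₂ | weight-comm b (c + d) d e
        with m≤n⇒m<n∨m≡n c≤b | m≤n⇒m<n∨m≡n d≤e
      ... | inj₁ p | inj₁ q
        rewrite cmp-> p | weight-outside {e + b} {d} {c} {b} (lin 0 (d≤e ⊕ p) (solve (d ∷ e ∷ b ∷ c ∷ [])))
              | weight-outside {e + b + c} {b} {c + d} {e + b} (lin 0 q (solve (d ∷ e ∷ b ∷ c ∷ [])))
              | weight-interior {c + d} {b} {d} {e} (lin 0 p (solve (d ∷ b ∷ c ∷ []))) (lin d b<c+d (solve (d ∷ b ∷ c ∷ []))) q = refl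
      ... | inj₁ p | inj₂ q
        rewrite cmp-> p | weight-outside {e + b} {d} {c} {b} (lin 0 (d≤e ⊕ p) (solve (d ∷ e ∷ b ∷ c ∷ [])))
              | weight-side {e + b + c} {b} {c + d} {e + b} (trans (cong (λ x → x + b + c) (sym q)) (solve (d ∷ b ∷ c ∷ []))) (lin c d>0 (solve (c ∷ d ∷ []))) (lin 0 (d≤e ⊕ p) (solve (d ∷ e ∷ b ∷ c ∷ [])))
              | weight-arc {c + d} {b} {d} {e} (lin 0 p (solve (d ∷ b ∷ c ∷ []))) (lin d b<c+d (solve (d ∷ b ∷ c ∷ []))) q = refl
      ... | inj₂ p | inj₁ q
        rewrite cmp-≡ (sym p) | weight-outside {e + b} {d} {c} {b} (lin 0 (c≤b ⊕ q) (solve (d ∷ e ∷ b ∷ c ∷ [])))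
              | weight-outside {e + b + c} {b} {c + d} {e + b} (lin 0 q (solve (d ∷ e ∷ b ∷ c ∷ [])))
              | weight-side {c + d} {b} {d} {e} (cong (_+ d) p) d>0 q = refl
      -- The double tie: three corners together give the 3 of the tie `b = c`.
      ... | inj₂ p | inj₂ q
        rewrite cmp-≡ (sym p) | weight-corner {e + b} {d} {c} {b} (cong₂ _+_ (sym q) (sym p)) (subst (0 <_) (sym p) b>0) p
              | weight-corner {e + b + c} {b} {c + d} {e + b} (trans (cong (λ x → x + b + c) (sym q)) (solve (d ∷ b ∷ c ∷ []))) (lin c d>0 (solve (c ∷ d ∷ []))) (trans (+-comm c d) (cong₂ _+_ q p))
              | weight-corner {c + d} {b} {d} {e} (cong (_+ d) p) d>0 q = refl
    -- The potential is 12 before the step and is again a sum of two halves after it. Each tie in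
    -- the new comparisons loses 3, and exactly then one of the matrices is on a side of the strip.
    ... | inj₂ d≤e | inj₂ c+d≤b = trans (cong (stepWeight e b c d +_) (potential-high d≤e c+d≤b)) sub
      where
      d<a : d < (e + b)
      d<a = lin 0 (d≤e ⊕ b>0) (solve (d ∷ e ∷ b ∷ []))
      c<b : c < b
      c<b = lin 0 (c+d≤b ⊕ d>0) (solve (c ∷ d ∷ b ∷ []))
      sub : stepWeight e b c d + (half (cmp e d) + half (cmp b (c + d))) ≡ half (cmp (e + b) d) + half (cmp b c)
      sub rewrite cmp-> d<a | cmp-> c<b | weight-outside {e + b} {d} {c} {b} (lin 0 (d≤e ⊕ c<b) (solve (d ∷ e ∷ b ∷ c ∷ [])))
        with m≤n⇒m<n∨m≡n c+d≤b | m≤n⇒m<n∨m≡n d≤e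
      ... | inj₁ p | inj₁ q
        rewrite weight-outside {b} {c} {d} {e + b} p | weight-outside {e + b + c} {b} {c + d} {e + b} (lin 0 q (solve (d ∷ e ∷ b ∷ c ∷ [])))
              | cmp-> p | cmp-> q = refl
      ... | inj₁ p | inj₂ q
        rewrite weight-outside {b} {c} {d} {e + b} p
              | weight-side {e + b + c} {b} {c + d} {e + b} (trans (cong (λ x → x + b + c) (sym q)) (solve (d ∷ b ∷ c ∷ []))) (lin c d>0 (solve (c ∷ d ∷ []))) (lin e p (solve (d ∷ e ∷ b ∷ c ∷ [])))
              | cmp-> p | cmp-≡ (sym q) = refl
      ... | inj₂ p | inj₁ q
        rewrite weight-side {b} {c} {d} {e + b} (sym p) d>0 d<a | weight-outside {e + b + c} {b} {c + d} {e + b} (lin 0 q (solve (d ∷ e ∷ b ∷ c ∷ [])))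
              | cmp-≡ (sym p) | cmp-> q = refl
      ... | inj₂ p | inj₂ q
        rewrite weight-side {b} {c} {d} {e + b} (sym p) d>0 d<a
              | weight-side {e + b + c} {b} {c + d} {e + b} (trans (cong (λ x → x + b + c) (sym q)) (solve (d ∷ b ∷ c ∷ []))) (lin c d>0 (solve (c ∷ d ∷ []))) (lin 0 (c+d≤b ⊕ d≤e ⊕ d>0) (solve (d ∷ e ∷ b ∷ c ∷ [])))
              | cmp-≡ (sym p) | cmp-≡ (sym q) = refl

  -- Positivity of `c` is essential: for `c = 0`, `d = e + b` and `e`, `b` positive, the left side
  -- is 9 and the right side 6.
  step : ∀ e b {c d} → 0 < c → 0 < d → potential (e + b) b c d ≡ stepWeight e b c d + potential e b (c + d) d
  step e b {c} {d} c>0 d>0 with <-≤-connex (e + b) d | <-≤-connex b c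
  ... | inj₁ p | _ = step-a<d {e} {b} {c} {d} p
  ... | inj₂ p | inj₁ q = step-b<c {e} {b} {c} {d} p q
  ... | inj₂ p | inj₂ q =
    step-high {e} {b} {c} {d} p q d>0 (≤-trans c>0 q) (m≤n⇒m≤o+n e c>0) (inj₁ c>0)

-- The chain of states, the matrices attached to it, and its total weight.

module States where
  open Weights
  open import Defs using (Mat; mat)
  open import Data.Nat
  open import Data.Nat.Properties
  open import Data.Nat.Tactic.RingSolver using (solve)
  open import Data.Integer as ℤ using ()
  open import Data.List using (List; []; _∷_; _++_; map)
  open import Data.Nat.ListAction using (sum)
  open import Data.List.Properties using (map-++)
  open import Data.Nat.ListAction.Properties using (sum-++)
  open import Data.Product using (_×_; _,_; proj₁)
  open import Data.Sum using (inj₁; inj₂)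
  open import Data.Empty
  open import Relation.Nullary
  open import Relation.Binary.Definitions using (tri<; tri≈; tri>)
  open import Relation.Binary.PropositionalEquality

  -- ⟨ a , b , c , d ⟩ stands for the basis (a , c) , (- b , d).
  record State : Set where
    constructor ⟨_,_,_,_⟩
    field
      x₁ x₂ y₁ y₂ : ℕ
  open State public

  next : State → State
  next ⟨ a , b , c , d ⟩ with b <? a
  ... | yes _ = ⟨ a ∸ b , b , c + d , d ⟩
  ... | no  _ = ⟨ a , b ∸ a , c , c + d ⟩

  basis : State → Mat
  basis ⟨ a , b , c , d ⟩ = mat (ℤ.+ a) (ℤ.- ℤ.+ b) (ℤ.+ c) (ℤ.+ d)

  rotated : State → Mat
  rotated ⟨ a , b , c , d ⟩ = mat (ℤ.- ℤ.+ b) (ℤ.- ℤ.+ a) (ℤ.+ d) (ℤ.- ℤ.+ c)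

  -- The matrix is the basis times (1 -1; 1 0), respectively (1 0; 1 1).
  diagonal : State → ℕ × Mat
  diagonal ⟨ a , b , c , d ⟩ with b <? a
  ... | yes _ = weight (a + c) b (c + d) a , mat (ℤ.+ a ℤ.- ℤ.+ b) (ℤ.- ℤ.+ a) (ℤ.+ (c + d)) (ℤ.- ℤ.+ c)
  ... | no  _ = weight (b + d) a (d + c) b , mat (ℤ.+ a ℤ.- ℤ.+ b) (ℤ.- ℤ.+ b) (ℤ.+ (d + c)) (ℤ.+ d)

  items : State → List (ℕ × Mat)
  items s@(⟨ a , b , c , d ⟩) =
    (weight a d c b , basis s) ∷ (weight b c d a , rotated s) ∷ diagonal s ∷ []

  totalWeight : List (ℕ × Mat) → ℕ
  totalWeight l = sum (map proj₁ l)

  totalWeight-++ : ∀ l l' → totalWeight (l ++ l') ≡ totalWeight l + totalWeight l'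
  totalWeight-++ l l' = trans (cong sum (map-++ proj₁ l l')) (sum-++ (map proj₁ l) (map proj₁ l'))

  Φ : State → ℕ
  Φ ⟨ a , b , c , d ⟩ = potential a b c d

  data Split : ℕ → ℕ → Set where
    right : ∀ {e b} → 0 < e → Split (e + b) b
    left  : ∀ {a f} → Split a (f + a)

  split : ∀ a b → Split a b
  split a b with <-≤-connex b a
  ... | inj₁ p = subst (λ x → Split x b) (m∸n+n≡m (<⇒≤ p)) (right (m<n⇒0<n∸m p))
  ... | inj₂ p = subst (Split a) (m∸n+n≡m p) left

  next-right : ∀ {e b c d} → 0 < e → next ⟨ e + b , b , c , d ⟩ ≡ ⟨ e , b , c + d , d ⟩
  next-right {e} {b} p with b <? e + b
  ... | yes _ rewrite m+n∸n≡m e b = refl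
  ... | no ¬p = ⊥-elim (¬p (+-monoˡ-≤ b p))

  next-left : ∀ {a f c d} → next ⟨ a , f + a , c , d ⟩ ≡ ⟨ a , f , c , c + d ⟩
  next-left {a} {f} with f + a <? a
  ... | yes p = ⊥-elim (m+n≮n f a p)
  ... | no  _ rewrite m+n∸n≡m f a = refl

  diagonal-right : ∀ {e b c d} → 0 < e → diagonal ⟨ e + b , b , c , d ⟩ ≡
    (weight (e + b + c) b (c + d) (e + b) , mat (ℤ.+ (e + b) ℤ.- ℤ.+ b) (ℤ.- ℤ.+ (e + b)) (ℤ.+ (c + d)) (ℤ.- ℤ.+ c))
  diagonal-right {e} {b} p with b <? e + b
  ... | yes _ = refl
  ... | no ¬p = ⊥-elim (¬p (+-monoˡ-≤ b p))

  diagonal-left : ∀ {a f c d} → diagonal ⟨ a , f + a , c , d ⟩ ≡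
    (weight (f + a + d) a (d + c) (f + a) , mat (ℤ.+ a ℤ.- ℤ.+ (f + a)) (ℤ.- ℤ.+ (f + a)) (ℤ.+ (d + c)) (ℤ.+ d))
  diagonal-left {a} {f} with f + a <? a
  ... | yes p = ⊥-elim (m+n≮n f a p)
  ... | no  _ = refl

  sum₃ : ∀ x y z → x + (y + (z + 0)) ≡ x + y + z
  sum₃ x y z = solve (x ∷ y ∷ z ∷ [])

  items-right : ∀ e b c d → 0 < e → totalWeight (items ⟨ e + b , b , c , d ⟩) ≡ stepWeight e b c d
  items-right e b c d p rewrite diagonal-right {e} {b} {c} {d} p =
    sum₃ (weight (e + b) d c b) (weight b c d (e + b)) _

  items-left : ∀ a f c d → totalWeight (items ⟨ a , f + a , c , d ⟩) ≡ stepWeight f a d c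
  items-left a f c d rewrite diagonal-left {a} {f} {c} {d} =
    trans (sum₃ (weight a d c (f + a)) (weight (f + a) c d a) _)
          (cong (_+ weight (f + a + d) a (d + c) (f + a)) (+-comm (weight a d c (f + a)) _))

  Positive : State → Set
  Positive s = 0 < y₁ s × 0 < y₂ s

  next-positive : ∀ s → Positive s → Positive (next s)
  next-positive ⟨ a , b , c , d ⟩ (p , q) with b <? a
  ... | yes _ = m≤n⇒m≤n+o d p , q
  ... | no  _ = p , m≤n⇒m≤n+o d p

  Φ-next : ∀ s → Positive s → Φ s ≡ totalWeight (items s) + Φ (next s)
  Φ-next ⟨ a , b , c , d ⟩ (c>0 , d>0) with split a b
  ... | right {e} p rewrite items-right e b c d p | next-right {e} {b} {c} {d} p = step e b c>0 d>0
  -- Swapping the basis vectors turns this step into the other one; afterwards they are swapped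
  -- back.
  ... | left {f = f} rewrite items-left a f c d | next-left {a} {f} {c} {d} =
    trans (potential-swap a (f + a) c d) (trans (step f a d>0 c>0)
      (cong (stepWeight f a d c +_) (trans (potential-swap f a (d + c) c) (cong (potential a f c) (+-comm d c)))))

  weight≢0⇒≤ : ∀ {a d c b} → weight a d c b ≢ 0 → a ≤ d + c × d ≤ a + c × c ≤ b
  weight≢0⇒≤ {a} {d} {c} {b} h =
      ≮⇒≥ (λ p → h (weight-outside {a} {d} {c} {b} p))
    , ≮⇒≥ (λ p → h (trans (weight-comm a d c b) (weight-outside {d} {a} {c} {b} p)))
    , ≮⇒≥ (λ p → h (weight-below {a} {d} p))

  -- In each branch of the potential a nonzero value bounds the second coordinates by the first:
  -- `c + d` is at most `a + 2 * b`, at most `b + 2 * a`, or at most `a + b`.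
  Φ-vanishes : ∀ s → 2 * (x₁ s + x₂ s) < y₁ s + y₂ s → Φ s ≡ 0
  Φ-vanishes ⟨ a , b , c , d ⟩ h with potential a b c d ≟ 0
  ... | yes p = p
  ... | no  p with <-≤-connex a d | <-≤-connex b c
  ...   | inj₁ q | _ =
    let (_ , r , t) = weight≢0⇒≤ {a} {d} {c} {b} (λ z → p (trans (potential-a<d {a} {b} {c} {d} q) z))
    in ⊥-elim (<-irrefl {0} refl (lin a (h ⊕ r ⊕ t ⊕ t) (solve (a ∷ b ∷ c ∷ d ∷ []))))
  ...   | inj₂ q | inj₁ r =
    let (_ , t , _) = weight≢0⇒≤ {b} {c} {d} {a} (λ z → p (trans (potential-b<c {a} {b} {c} {d} q r) z))
    in ⊥-elim (<-irrefl {0} refl (lin b (h ⊕ t ⊕ q ⊕ q) (solve (a ∷ b ∷ c ∷ d ∷ []))))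
  ...   | inj₂ q | inj₂ r = ⊥-elim (<-irrefl {0} refl (lin (a + b) (h ⊕ q ⊕ r) (solve (a ∷ b ∷ c ∷ d ∷ []))))

  iterate : ℕ → State → State
  iterate zero s = s
  iterate (suc k) s = iterate k (next s)

  trail : ℕ → State → List (ℕ × Mat)
  trail zero s = []
  trail (suc k) s = items s ++ trail k (next s)

  -- The first coordinates never grow, while `c + d` gains at least one per step, so `k` serves as
  -- fuel that runs out only after the bound of `Φ-vanishes` is met.
  size-next : ∀ k s → Positive s → 2 * (x₁ s + x₂ s) < y₁ s + y₂ s + suc k →
    2 * (x₁ (next s) + x₂ (next s)) < y₁ (next s) + y₂ (next s) + k
  size-next k ⟨ a , b , c , d ⟩ (c>0 , d>0) h with split a b
  ... | right {e} p rewrite next-right {e} {b} {c} {d} p =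
    lin (b + b) (h ⊕ d>0) (solve (e ∷ b ∷ c ∷ d ∷ k ∷ []))
  ... | left {f = f} rewrite next-left {a} {f} {c} {d} =
    lin (a + a) (h ⊕ c>0) (solve (a ∷ f ∷ c ∷ d ∷ k ∷ []))

  Φ-iterate-vanishes : ∀ k s → Positive s → 2 * (x₁ s + x₂ s) < y₁ s + y₂ s + k → Φ (iterate k s) ≡ 0
  Φ-iterate-vanishes zero s s>0 h = Φ-vanishes s (subst (2 * (x₁ s + x₂ s) <_) (+-identityʳ _) h)
  Φ-iterate-vanishes (suc k) s s>0 h =
    Φ-iterate-vanishes k (next s) (next-positive s s>0) (size-next k s s>0 h)

  trail-weight : ∀ k s → Positive s → totalWeight (trail k s) + Φ (iterate k s) ≡ Φ s
  trail-weight zero s s>0 = refl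
  trail-weight (suc k) s s>0 = begin
    totalWeight (items s ++ trail k (next s)) + Φ (iterate k (next s))
      ≡⟨ cong (_+ Φ (iterate k (next s))) (totalWeight-++ (items s) (trail k (next s))) ⟩
    totalWeight (items s) + totalWeight (trail k (next s)) + Φ (iterate k (next s))
      ≡⟨ +-assoc (totalWeight (items s)) _ _ ⟩
    totalWeight (items s) + (totalWeight (trail k (next s)) + Φ (iterate k (next s)))
      ≡⟨ cong (totalWeight (items s) +_) (trail-weight k (next s) (next-positive s s>0)) ⟩
    totalWeight (items s) + Φ (next s)
      ≡⟨ Φ-next s s>0 ⟨
    Φ s ∎
    where open ≡-Reasoning

  -- With `c = 0` the strip has width zero: it admits only `a = d`, and there both strip comparisons
  -- are ties, for which the table holds 0.
  weight-zero : ∀ a d b → weight a d 0 b ≡ 0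
  weight-zero a d b with <-cmp a d
  ... | tri< p _ _ = trans (weight-comm a d 0 b) (weight-outside {d} {a} {0} {b} (subst (_< d) (sym (+-identityʳ a)) p))
  ... | tri≈ _ refl _ rewrite cmp-≡ {a} (sym (+-identityʳ a)) = refl
  ... | tri> _ _ p = weight-outside {a} {d} {0} {b} (subst (_< a) (sym (+-identityʳ d)) p)

  -- The weights of the first two states of the chain, which have c = 0, plus the potential of the third.
  startWeight : ℕ → ℕ → ℕ → ℕ
  startWeight e b d = stepWeight b (e + b) d 0 + (stepWeight e b 0 d + potential e b d d)

  startWeight-< : ∀ e b d → 0 < d → e + b < d → startWeight e b d ≡ 0
  startWeight-< e b d d>0 p
    -- For `e + b < d` the telescoping identity survives at `c = 0`, so everything after the first
    -- state folds into one potential, whose value is a weight with third argument 0.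
    rewrite sym (step-a<d {e} {b} {0} {d} p) | potential-a<d {e + b} {b} {0} {d} p
          | weight-zero (e + b) d b | weight-zero (e + b) d (b + (e + b))
          | weight-below {b + (e + b)} {0} {d} {e + b} p
    with b ≟ 0
  ... | yes refl = cong (_+ 0) (weight-below {e + 0 + d} {e + 0} {d + 0} {e + 0} (lin 0 p (solve (e ∷ d ∷ []))))
  ... | no q = cong (_+ 0) (weight-outside {b + (e + b) + d} {e + b} {d + 0} {b + (e + b)}
                 (lin 0 (n≢0⇒n>0 q) (solve (e ∷ b ∷ d ∷ []))))

  cong₇ : ∀ {x₁ x₂ x₃ y₁ y₂ y₃ z x₁′ x₂′ x₃′ y₁′ y₂′ y₃′ z′ : ℕ} →
    x₁ ≡ x₁′ → x₂ ≡ x₂′ → x₃ ≡ x₃′ → y₁ ≡ y₁′ → y₂ ≡ y₂′ → y₃ ≡ y₃′ → z ≡ z′ →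
    x₁ + x₂ + x₃ + (y₁ + y₂ + y₃ + z) ≡ x₁′ + x₂′ + x₃′ + (y₁′ + y₂′ + y₃′ + z′)
  cong₇ refl refl refl refl refl refl refl = refl

  -- The first state has no weight, and `step-high` applies to the second one although its `c` is 0.
  -- Its potential is 6 + 6, since `d < e + b` and `0 < b`.
  startWeight->⁺ : ∀ e b d → 0 < e → 0 < b → 0 < d → d < e + b → startWeight e b d ≡ 12
  startWeight->⁺ e b d e>0 b>0 d>0 p = cong₂ _+_
    (cong₂ _+_ (cong₂ _+_
      (weight-outside {b + (e + b)} {0} {d} {e + b} (lin b p (solve (e ∷ b ∷ d ∷ []))))
      (weight-zero (e + b) d (b + (e + b))))
      (weight-outside {b + (e + b) + d} {e + b} {d + 0} {b + (e + b)} (lin 0 b>0 (solve (e ∷ b ∷ d ∷ [])))))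
    (trans (sym (step-high {e} {b} {0} {d} (<⇒≤ p) z≤n d>0 b>0 (m≤n⇒m≤n+o 0 e>0) (inj₂ p)))
      (trans (potential-high {e + b} {b} {0} {d} (<⇒≤ p) z≤n)
        (cong₂ _+_ (cong half (cmp-> p)) (cong half (cmp-> b>0)))))

  startWeight-> : ∀ e b d → 0 < e → 0 < d → d < e + b → startWeight e b d ≡ 12
  -- With `b = 0` the total 12 arises as 3 + 6 + 3: two points on the sides of the strip and one
  -- interior point.
  startWeight-> e zero d e>0 d>0 p = cong₇
    (weight-outside {e + 0} {0} {d} {e + 0} p)
    (weight-zero (e + 0) d (e + 0))
    (weight-side {e + 0 + d} {e + 0} {d + 0} {e + 0} (solve (e ∷ d ∷ [])) (lin 0 d>0 (solve (d ∷ [])))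
      (lin 0 p (solve (e ∷ d ∷ []))))
    (weight-zero (e + 0) d 0)
    (weight-interior {0} {0} {d} {e + 0} d>0 d>0 p)
    (weight-outside {e + 0 + 0} {0} {d} {e + 0} (lin 0 p (solve (e ∷ d ∷ []))))
    (trans (potential-b<c {e} {0} {d} {d} (<⇒≤ d<e) d>0)
      (trans (weight-comm 0 d d e) (weight-side {d} {0} {d} {e} refl d>0 d<e)))
    where
    d<e : d < e
    d<e = subst (d <_) (+-identityʳ e) p
  startWeight-> e b@(suc _) d e>0 d>0 p = startWeight->⁺ e b d e>0 z<s d>0 p

  -- Four corners and one point of the arc. This is the root coset, whose matrices are multiples of
  -- elements of Γ: the elliptic ones that count are one fixing i and two fixing each of the two
  -- corners.
  startWeight-≡0 : ∀ d → 0 < d → startWeight d 0 d ≡ 7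
  startWeight-≡0 d d>0 = cong₇
    (weight-corner {d + 0} {0} {d} {d + 0} (+-identityʳ d) d>0 (sym (+-identityʳ d)))
    (weight-zero (d + 0) d (d + 0))
    (weight-corner {d + 0 + d} {d + 0} {d + 0} {d + 0} (solve (d ∷ [])) (lin 0 d>0 (solve (d ∷ []))) refl)
    (weight-zero (d + 0) d 0)
    (weight-arc {0} {0} {d} {d + 0} d>0 d>0 (sym (+-identityʳ d)))
    (weight-corner {d + 0 + 0} {0} {d} {d + 0} (solve (d ∷ [])) d>0 (sym (+-identityʳ d)))
    (trans (potential-b<c {d} {0} {d} {d} ≤-refl d>0)
      (trans (weight-comm 0 d d d) (weight-corner {d} {0} {d} {d} refl d>0 refl)))

  -- The 6 consists of two points on the arc, from the rotated and the diagonal matrix of the second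
  -- state.
  startWeight-≡ : ∀ e b d → 0 < e → 0 < b → d ≡ e + b → startWeight e b d ≡ 6
  startWeight-≡ e b d e>0 b>0 refl
    rewrite weight-zero (e + b) d (b + (e + b)) | weight-zero (e + b) d b
          | weight-outside {b + (e + b)} {0} {d} {e + b} (lin 0 b>0 (solve (e ∷ b ∷ [])))
          | weight-outside {b + (e + b) + d} {e + b} {d + 0} {b + (e + b)} (lin 0 b>0 (solve (e ∷ b ∷ [])))
          | weight-arc {b} {0} {d} {d} (lin 0 e>0 (solve (e ∷ b ∷ []))) (lin (e + b) b>0 (solve (e ∷ b ∷ []))) refl
          | weight-arc {e + b + 0} {b} {d} {d} (lin 0 b>0 (solve (e ∷ b ∷ []))) (lin (e + b) e>0 (solve (e ∷ b ∷ []))) refl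
          | potential-a<d {e} {b} {d} {d} (lin 0 b>0 (solve (e ∷ b ∷ [])))
          | weight-below {e} {d} {d} {b} (lin 0 e>0 (solve (e ∷ b ∷ []))) = refl

-- The value of `χ` at a fixed point, computed from integer comparisons.

module FixedPoints where
  open Weights
  open import Defs
  open import Data.Nat as ℕ using (ℕ; suc; s≤s; z≤n)
  import Data.Nat.Properties as ℕₚ
  open import Data.Integer as ℤ using (ℤ)
  import Data.Integer.Properties as ℤₚ
  open import Data.Integer.Tactic.RingSolver using (solve)
  open import Data.List using ([]; _∷_)
  open import Data.Rational as ℚ using (ℚ; 0ℚ; 1ℚ; ½; _/_; toℚᵘ)
  import Data.Rational.Properties as ℚₚ
  open import Data.Rational.Unnormalised as ℚᵘ using (mkℚᵘ; *≡*; *<*)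
  import Data.Rational.Unnormalised.Properties as ℚᵘₚ
  open import Data.Product using (_,_; proj₁; proj₂)
  open import Data.Bool using (true; false)
  open import Relation.Nullary using (does)
  open import Relation.Nullary.Decidable using (dec-true; dec-false)
  open import Relation.Binary.Definitions using (tri<; tri≈; tri>)
  open import Relation.Binary.PropositionalEquality

  pattern pos n = ℤ.+ n

  -- `_/_` reduces by a gcd that does not evaluate on open terms, so comparisons of fractions go
  -- through unnormalised rationals.
  frac-< : ∀ {i j m n} → i ℤ.* pos (suc n) ℤ.< j ℤ.* pos (suc m) → i / suc m ℚ.< j / suc n
  frac-< {i} {j} {m} {n} p = ℚₚ.toℚᵘ-cancel-<
    (ℚᵘₚ.<-respˡ-≃ (ℚᵘₚ.≃-sym (ℚₚ.toℚᵘ-fromℚᵘ (mkℚᵘ i m)))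
      (ℚᵘₚ.<-respʳ-≃ (ℚᵘₚ.≃-sym (ℚₚ.toℚᵘ-fromℚᵘ (mkℚᵘ j n))) (*<* p)))

  frac-≡ : ∀ {i j m n} → i ℤ.* pos (suc n) ≡ j ℤ.* pos (suc m) → i / suc m ≡ j / suc n
  frac-≡ {i} {j} {m} {n} p = ℚₚ.fromℚᵘ-cong {mkℚᵘ i m} {mkℚᵘ j n} (*≡* p)

  ∣frac∣ : ∀ i m → ℚ.∣ i / suc m ∣ ≡ pos ℤ.∣ i ∣ / suc m
  ∣frac∣ i m = ℚₚ.toℚᵘ-injective (begin
    toℚᵘ ℚ.∣ i / suc m ∣      ≈⟨ ℚₚ.toℚᵘ-homo-∣-∣ (i / suc m) ⟩
    ℚᵘ.∣ toℚᵘ (i / suc m) ∣   ≈⟨ ℚᵘₚ.∣-∣-cong (ℚₚ.toℚᵘ-fromℚᵘ (mkℚᵘ i m)) ⟩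
    ℚᵘ.∣ mkℚᵘ i m ∣           ≈⟨ ℚₚ.toℚᵘ-fromℚᵘ (mkℚᵘ (pos ℤ.∣ i ∣) m) ⟨
    toℚᵘ (pos ℤ.∣ i ∣ / suc m) ∎)
    where open ℚᵘₚ.≃-Reasoning

  module _ (α β δ : ℤ) (k : ℕ) where
    private
      M = mat α β (pos (suc k)) δ
      x = proj₁ (fixPt M)
      y = proj₂ (fixPt M)
      g = ℤ.∣ α ℤ.- δ ∣

    ∣x∣<½ : g ℕ.< suc k → ℚ.∣ x ∣ ℚ.< ½
    ∣x∣<½ p rewrite ∣frac∣ (α ℤ.- δ) (k ℕ.+ 1 ℕ.* suc k) = frac-< {pos g} {pos 1} {k ℕ.+ 1 ℕ.* suc k} {1}
      (subst₂ ℤ._<_ (ℤₚ.pos-* g 2) (sym (ℤₚ.*-identityˡ _)) (ℤ.+<+ (subst (ℕ._< 2 ℕ.* suc k) (ℕₚ.*-comm 2 g) (ℕₚ.*-monoʳ-< 2 p))))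

    ∣x∣≡½ : g ≡ suc k → ℚ.∣ x ∣ ≡ ½
    ∣x∣≡½ p rewrite ∣frac∣ (α ℤ.- δ) (k ℕ.+ 1 ℕ.* suc k) = frac-≡ {pos g} {pos 1} {k ℕ.+ 1 ℕ.* suc k} {1}
      (trans (sym (ℤₚ.pos-* g 2)) (trans (cong pos (trans (cong (ℕ._* 2) p) (ℕₚ.*-comm (suc k) 2))) (sym (ℤₚ.*-identityˡ _))))

    ½<∣x∣ : suc k ℕ.< g → ½ ℚ.< ℚ.∣ x ∣
    ½<∣x∣ p rewrite ∣frac∣ (α ℤ.- δ) (k ℕ.+ 1 ℕ.* suc k) = frac-< {pos 1} {pos g} {1} {k ℕ.+ 1 ℕ.* suc k}
      (subst₂ ℤ._<_ (sym (ℤₚ.*-identityˡ _)) (ℤₚ.pos-* g 2) (ℤ.+<+ (subst (2 ℕ.* suc k ℕ.<_) (ℕₚ.*-comm 2 g) (ℕₚ.*-monoʳ-< 2 p))))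

    -- The fixed point and its conjugate are the roots of c z² + (δ - α) z - β, and the product of
    -- the roots is - β / c.
    ∣z∣² : x ℚ.* x ℚ.+ y ≡ (ℤ.- β) / suc k
    ∣z∣² = ℚₚ.toℚᵘ-injective (begin
      toℚᵘ (x ℚ.* x ℚ.+ y)                   ≈⟨ ℚₚ.toℚᵘ-homo-+ (x ℚ.* x) y ⟩
      toℚᵘ (x ℚ.* x) ℚᵘ.+ toℚᵘ y             ≈⟨ ℚᵘₚ.+-congˡ (toℚᵘ y) (ℚₚ.toℚᵘ-homo-* x x) ⟩
      toℚᵘ x ℚᵘ.* toℚᵘ x ℚᵘ.+ toℚᵘ y         ≈⟨ ℚᵘₚ.+-cong (ℚᵘₚ.*-cong X≃ X≃) (ℚₚ.toℚᵘ-fromℚᵘ Y) ⟩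
      X ℚᵘ.* X ℚᵘ.+ Y                        ≈⟨ *≡* identity ⟩
      mkℚᵘ (ℤ.- β) k                          ≈⟨ ℚₚ.toℚᵘ-fromℚᵘ (mkℚᵘ (ℤ.- β) k) ⟨
      toℚᵘ ((ℤ.- β) / suc k) ∎)
      where
      open ℚᵘₚ.≃-Reasoning
      C = suc k
      e = α ℤ.- δ
      f = pos 4 ℤ.* det M ℤ.- tr M ℤ.* tr M
      X = mkℚᵘ e (k ℕ.+ 1 ℕ.* C)
      Y = mkℚᵘ f (ℕ.pred (4 ℕ.* (C ℕ.* C)))
      X≃ = ℚₚ.toℚᵘ-fromℚᵘ X
      poly : ∀ α β δ c → ((α ℤ.- δ) ℤ.* (α ℤ.- δ) ℤ.* (pos 4 ℤ.* (c ℤ.* c)) ℤ.+ (pos 4 ℤ.* (α ℤ.* δ ℤ.- β ℤ.* c) ℤ.- (α ℤ.+ δ) ℤ.* (α ℤ.+ δ)) ℤ.* (pos 2 ℤ.* c ℤ.* (pos 2 ℤ.* c))) ℤ.* c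
           ≡ ℤ.- β ℤ.* (pos 2 ℤ.* c ℤ.* (pos 2 ℤ.* c) ℤ.* (pos 4 ℤ.* (c ℤ.* c)))
      poly α β δ c = solve (α ∷ β ∷ δ ∷ c ∷ [])
      4CC : pos (4 ℕ.* (C ℕ.* C)) ≡ pos 4 ℤ.* (pos C ℤ.* pos C)
      4CC = trans (ℤₚ.pos-* 4 (C ℕ.* C)) (cong (pos 4 ℤ.*_) (ℤₚ.pos-* C C))
      2C2C : pos ((2 ℕ.* C) ℕ.* (2 ℕ.* C)) ≡ pos 2 ℤ.* pos C ℤ.* (pos 2 ℤ.* pos C)
      2C2C = trans (ℤₚ.pos-* (2 ℕ.* C) (2 ℕ.* C)) (cong₂ ℤ._*_ (ℤₚ.pos-* 2 C) (ℤₚ.pos-* 2 C))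
      identity : (e ℤ.* e ℤ.* pos (4 ℕ.* (C ℕ.* C)) ℤ.+ f ℤ.* pos ((2 ℕ.* C) ℕ.* (2 ℕ.* C))) ℤ.* pos C
               ≡ ℤ.- β ℤ.* pos (((2 ℕ.* C) ℕ.* (2 ℕ.* C)) ℕ.* (4 ℕ.* (C ℕ.* C)))
      identity = trans
        (cong (ℤ._* pos C) (cong₂ ℤ._+_ (cong (e ℤ.* e ℤ.*_) 4CC) (cong (f ℤ.*_) 2C2C)))
        (trans (poly α β δ (pos C))
          (cong (ℤ.- β ℤ.*_) (sym (trans (ℤₚ.pos-* ((2 ℕ.* C) ℕ.* (2 ℕ.* C)) (4 ℕ.* (C ℕ.* C))) (cong₂ ℤ._*_ 2C2C 4CC)))))

    1<∣z∣² : pos (suc k) ℤ.< ℤ.- β → 1ℚ ℚ.< x ℚ.* x ℚ.+ y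
    1<∣z∣² p = subst (1ℚ ℚ.<_) (sym ∣z∣²) (frac-< {pos 1} {ℤ.- β} {0} {k}
      (subst₂ ℤ._<_ (sym (ℤₚ.*-identityˡ _)) (sym (ℤₚ.*-identityʳ _)) p))

    ∣z∣²≡1 : pos (suc k) ≡ ℤ.- β → x ℚ.* x ℚ.+ y ≡ 1ℚ
    ∣z∣²≡1 p = trans ∣z∣² (frac-≡ {ℤ.- β} {pos 1} {k} {0}
      (trans (ℤₚ.*-identityʳ _) (trans (sym p) (sym (ℤₚ.*-identityˡ _)))))

    ∣z∣²<1 : ℤ.- β ℤ.< pos (suc k) → x ℚ.* x ℚ.+ y ℚ.< 1ℚ
    ∣z∣²<1 p = subst (ℚ._< 1ℚ) (sym ∣z∣²) (frac-< {ℤ.- β} {pos 1} {k} {0}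
      (subst₂ ℤ._<_ (sym (ℤₚ.*-identityʳ _)) (sym (ℤₚ.*-identityˡ _)) p))

  module _ {x y : ℚ} where
    private r = x ℚ.* x ℚ.+ y

    χ-interior : ℚ.∣ x ∣ ℚ.< ½ → 1ℚ ℚ.< r → χ (x , y) ≡ 1ℚ
    χ-interior p q rewrite dec-true (ℚ.∣ x ∣ ℚₚ.<? ½) p | dec-true (1ℚ ℚₚ.<? r) q = refl

    χ-arc : ℚ.∣ x ∣ ℚ.< ½ → r ≡ 1ℚ → χ (x , y) ≡ ½
    χ-arc p q rewrite dec-true (ℚ.∣ x ∣ ℚₚ.<? ½) p
      | dec-false (1ℚ ℚₚ.<? r) (ℚₚ.<-irrefl (sym q)) | dec-true (r ℚₚ.≟ 1ℚ) q = refl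

    χ-side : ℚ.∣ x ∣ ≡ ½ → 1ℚ ℚ.< r → χ (x , y) ≡ ½
    χ-side p q rewrite dec-false (ℚ.∣ x ∣ ℚₚ.<? ½) (ℚₚ.<-irrefl p)
      | dec-true (ℚ.∣ x ∣ ℚₚ.≟ ½) p | dec-true (1ℚ ℚₚ.<? r) q = refl

    χ-corner : ℚ.∣ x ∣ ≡ ½ → r ≡ 1ℚ → χ (x , y) ≡ sixth
    χ-corner p q rewrite dec-false (ℚ.∣ x ∣ ℚₚ.<? ½) (ℚₚ.<-irrefl p)
      | dec-true (ℚ.∣ x ∣ ℚₚ.≟ ½) p
      | dec-false (1ℚ ℚₚ.<? r) (ℚₚ.<-irrefl (sym q)) | dec-true (r ℚₚ.≟ 1ℚ) q = refl

    χ-outside : ½ ℚ.< ℚ.∣ x ∣ → χ (x , y) ≡ 0ℚ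
    χ-outside p rewrite dec-false (ℚ.∣ x ∣ ℚₚ.<? ½) (ℚₚ.<-asym p)
      | dec-false (ℚ.∣ x ∣ ℚₚ.≟ ½) (λ e → ℚₚ.<-irrefl (sym e) p) = refl

    χ-below : r ℚ.< 1ℚ → χ (x , y) ≡ 0ℚ
    χ-below p rewrite dec-false (1ℚ ℚₚ.<? r) (ℚₚ.<-asym p)
      | dec-false (r ℚₚ.≟ 1ℚ) (λ e → ℚₚ.<-irrefl e p)
      with does (ℚ.∣ x ∣ ℚₚ.<? ½) | does (ℚ.∣ x ∣ ℚₚ.≟ ½)
    ... | true  | _ = refl
    ... | false | true = refl
    ... | false | false = refl

  sixths : ℕ → ℚ
  sixths n = pos n / 6

  neg-pos : ∀ B → ℤ.- (ℤ.- pos B) ≡ pos B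
  neg-pos B = ℤₚ.neg-involutive (pos B)

  -- The strip condition sees only the absolute value of `α - δ`, so that value against 0 stands in
  -- for the two diagonal entries, which may be negative.
  χM-weight : ∀ α δ k B → χM (mat α (ℤ.- pos B) (pos (suc k)) δ) ≡ sixths (weight ℤ.∣ α ℤ.- δ ∣ 0 (suc k) B)
  χM-weight α δ k B with ℕₚ.<-cmp ℤ.∣ α ℤ.- δ ∣ (suc k) | ℕₚ.<-cmp (suc k) B
  ... | tri> _ _ p | _ rewrite weight-outside {ℤ.∣ α ℤ.- δ ∣} {0} {suc k} {B} p = χ-outside (½<∣x∣ α (ℤ.- pos B) δ k p)
  ... | _ | tri> _ _ q rewrite weight-below {ℤ.∣ α ℤ.- δ ∣} {0} {suc k} {B} q =
    χ-below {proj₁ (fixPt (mat α (ℤ.- pos B) (pos (suc k)) δ))} (∣z∣²<1 α (ℤ.- pos B) δ k (subst (ℤ._< pos (suc k)) (sym (neg-pos B)) (ℤ.+<+ q)))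
  ... | tri< p _ _ | tri< q _ _ rewrite weight-interior {ℤ.∣ α ℤ.- δ ∣} {0} {suc k} {B} p (ℕₚ.m≤n⇒m≤o+n ℤ.∣ α ℤ.- δ ∣ (s≤s z≤n)) q =
    χ-interior (∣x∣<½ α (ℤ.- pos B) δ k p) (1<∣z∣² α (ℤ.- pos B) δ k (subst (pos (suc k) ℤ.<_) (sym (neg-pos B)) (ℤ.+<+ q)))
  ... | tri< p _ _ | tri≈ _ q _ rewrite weight-arc {ℤ.∣ α ℤ.- δ ∣} {0} {suc k} {B} p (ℕₚ.m≤n⇒m≤o+n ℤ.∣ α ℤ.- δ ∣ (s≤s z≤n)) q =
    χ-arc (∣x∣<½ α (ℤ.- pos B) δ k p) (∣z∣²≡1 α (ℤ.- pos B) δ k (trans (cong pos q) (sym (neg-pos B))))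
  ... | tri≈ _ p _ | tri< q _ _ rewrite weight-side {ℤ.∣ α ℤ.- δ ∣} {0} {suc k} {B} p (s≤s z≤n) q =
    χ-side (∣x∣≡½ α (ℤ.- pos B) δ k p) (1<∣z∣² α (ℤ.- pos B) δ k (subst (pos (suc k) ℤ.<_) (sym (neg-pos B)) (ℤ.+<+ q)))
  ... | tri≈ _ p _ | tri≈ _ q _ rewrite weight-corner {ℤ.∣ α ℤ.- δ ∣} {0} {suc k} {B} p (s≤s z≤n) q =
    χ-corner (∣x∣≡½ α (ℤ.- pos B) δ k p) (∣z∣²≡1 α (ℤ.- pos B) δ k (trans (cong pos q) (sym (neg-pos B))))

-- Right cosets, and the items as elliptic matrices with the stated weight.

module Cosets where
  open Weights
  open States
  open FixedPoints
  open import Defs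
  open import Data.Nat as ℕ using (ℕ; zero; suc; s≤s; z≤n; z<s)
  import Data.Nat.Properties as ℕₚ
  open import Data.Integer as ℤ using (ℤ; -[1+_]; 0ℤ; 1ℤ; -1ℤ; _+_; _*_; _-_; -_)
  import Data.Integer.Properties as ℤₚ
  open import Data.Integer.Tactic.RingSolver using (solve)
  open import Data.List using ([]; _∷_)
  open import Data.List.Relation.Unary.All as All using (All)
  open import Data.Product using (_×_; _,_; proj₁; proj₂)
  open import Data.Sum using (inj₁; inj₂)
  open import Data.Empty
  open import Relation.Nullary using (yes; no)
  open import Relation.Binary.PropositionalEquality

  mat-cong : ∀ {a b c d a′ b′ c′ d′} → a ≡ a′ → b ≡ b′ → c ≡ c′ → d ≡ d′ → mat a b c d ≡ mat a′ b′ c′ d′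
  mat-cong refl refl refl refl = refl

  ·-assoc : ∀ L M N → (L · M) · N ≡ L · (M · N)
  ·-assoc (mat a b c d) (mat e f g h) (mat i j k l) = mat-cong (row a b i k) (row a b j l) (row c d i k) (row c d j l)
    where
    row : ∀ a b i k → (a * e + b * g) * i + (a * f + b * h) * k ≡ a * (e * i + f * k) + b * (g * i + h * k)
    row a b i k = solve (a ∷ b ∷ e ∷ f ∷ g ∷ h ∷ i ∷ k ∷ [])

  det-· : ∀ M N → det (M · N) ≡ det M * det N
  det-· (mat a b c d) (mat e f g h) = identity a b c d e f g h
    where
    identity : ∀ a b c d e f g h →
      (a * e + b * g) * (c * f + d * h) - (a * f + b * h) * (c * e + d * g) ≡ (a * d - b * c) * (e * h - f * g)
    identity a b c d e f g h = solve (a ∷ b ∷ c ∷ d ∷ e ∷ f ∷ g ∷ h ∷ [])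

  adj : Mat → Mat
  adj (mat a b c d) = mat d (- b) (- c) a

  det-adj : ∀ M → det (adj M) ≡ det M
  det-adj (mat a b c d) = identity a b c d
    where
    identity : ∀ a b c d → d * a - (- b) * (- c) ≡ a * d - b * c
    identity a b c d = solve (a ∷ b ∷ c ∷ d ∷ [])

  ·-adj : ∀ M → M · adj M ≡ scalar (det M)
  ·-adj (mat a b c d) = mat-cong (one a b c d) (two a b) (two′ c d) (three a b c d)
    where
    one : ∀ a b c d → a * d + b * (- c) ≡ a * d - b * c
    one a b c d = solve (a ∷ b ∷ c ∷ d ∷ [])
    two : ∀ a b → a * (- b) + b * a ≡ 0ℤ
    two a b = solve (a ∷ b ∷ [])
    two′ : ∀ c d → c * d + d * (- c) ≡ 0ℤ
    two′ c d = solve (c ∷ d ∷ [])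
    three : ∀ a b c d → c * (- b) + d * a ≡ a * d - b * c
    three a b c d = solve (a ∷ b ∷ c ∷ d ∷ [])

  x*1+y*0 : ∀ x y → x * 1ℤ + y * 0ℤ ≡ x
  x*1+y*0 x y = solve (x ∷ y ∷ [])

  x*0+y*1 : ∀ x y → x * 0ℤ + y * 1ℤ ≡ y
  x*0+y*1 x y = solve (x ∷ y ∷ [])

  x*1+y*1 : ∀ x y → x * 1ℤ + y * 1ℤ ≡ x + y
  x*1+y*1 x y = solve (x ∷ y ∷ [])

  x*-1+y*0 : ∀ x y → x * -1ℤ + y * 0ℤ ≡ - x
  x*-1+y*0 x y = solve (x ∷ y ∷ [])

  x*y+z*1 : ∀ x y z → x * y + z * 1ℤ ≡ z + x * y
  x*y+z*1 x y z = solve (x ∷ y ∷ z ∷ [])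

  0*x+y : ∀ x y → 0ℤ * x + y ≡ y
  0*x+y x y = solve (x ∷ y ∷ [])

  ·-identityʳ : ∀ M → M · scalar 1ℤ ≡ M
  ·-identityʳ (mat a b c d) = mat-cong (x*1+y*0 a b) (x*0+y*1 a b) (x*1+y*0 c d) (x*0+y*1 c d)

  coset-sym : ∀ M N → InCoset M N → InCoset N M
  coset-sym M _ (γ , det≡1 , refl) = adj γ , trans (det-adj γ) det≡1 , (begin
    (M · γ) · adj γ      ≡⟨ ·-assoc M γ (adj γ) ⟩
    M · (γ · adj γ)      ≡⟨ cong (M ·_) (trans (·-adj γ) (cong scalar det≡1)) ⟩
    M · scalar 1ℤ        ≡⟨ ·-identityʳ M ⟩
    M ∎)
    where open ≡-Reasoning

  coset-trans : ∀ L M N → InCoset L M → InCoset M N → InCoset L N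
  coset-trans L _ _ (γ , det≡1 , refl) (γ′ , det′≡1 , refl) =
    γ · γ′ , trans (det-· γ γ′) (cong₂ _*_ det≡1 det′≡1) , sym (·-assoc L γ γ′)

  coset-rotated : ∀ s → InCoset (basis s) (rotated s)
  coset-rotated ⟨ a , b , c , d ⟩ = mat 0ℤ -1ℤ 1ℤ 0ℤ , refl ,
    mat-cong (x*0+y*1 (pos a) (- pos b)) (x*-1+y*0 (pos a) (- pos b)) (x*0+y*1 (pos c) (pos d)) (x*-1+y*0 (pos c) (pos d))

  coset-diagonal : ∀ s → InCoset (basis s) (proj₂ (diagonal s))
  coset-diagonal ⟨ a , b , c , d ⟩ with b ℕ.<? a
  ... | yes _ = mat 1ℤ -1ℤ 1ℤ 0ℤ , refl ,
    mat-cong (x*1+y*1 (pos a) (- pos b)) (x*-1+y*0 (pos a) (- pos b)) (x*1+y*1 (pos c) (pos d)) (x*-1+y*0 (pos c) (pos d))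
  ... | no _ = mat 1ℤ 0ℤ 1ℤ 1ℤ , refl ,
    mat-cong (x*1+y*1 (pos a) (- pos b)) (x*0+y*1 (pos a) (- pos b)) (trans (x*1+y*1 (pos c) (pos d)) (cong pos (ℕₚ.+-comm c d))) (x*0+y*1 (pos c) (pos d))

  coset-right : ∀ e b c d → InCoset (basis ⟨ e ℕ.+ b , b , c , d ⟩) (basis ⟨ e , b , c ℕ.+ d , d ⟩)
  coset-right e b c d = mat 1ℤ 0ℤ 1ℤ 1ℤ , refl ,
    mat-cong (cancel (pos e) (pos b)) (x*0+y*1 (pos e + pos b) (- pos b)) (x*1+y*1 (pos c) (pos d)) (x*0+y*1 (pos c) (pos d))
    where
    cancel : ∀ x y → (x + y) * 1ℤ + (- y) * 1ℤ ≡ x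
    cancel x y = solve (x ∷ y ∷ [])

  coset-left : ∀ a f c d → InCoset (basis ⟨ a , f ℕ.+ a , c , d ⟩) (basis ⟨ a , f , c , c ℕ.+ d ⟩)
  coset-left a f c d = mat 1ℤ 1ℤ 0ℤ 1ℤ , refl ,
    mat-cong (x*1+y*0 (pos a) (- (pos f + pos a))) (cancel (pos a) (pos f)) (x*1+y*0 (pos c) (pos d)) (x*1+y*1 (pos c) (pos d))
    where
    cancel : ∀ x y → x * 1ℤ + (- (y + x)) * 1ℤ ≡ - y
    cancel x y = solve (x ∷ y ∷ [])

  coset-next : ∀ s → InCoset (basis s) (basis (next s))
  coset-next ⟨ a , b , c , d ⟩ with split a b
  ... | right {e} p rewrite next-right {e} {b} {c} {d} p = coset-right e b c d
  ... | left {f = f} rewrite next-left {a} {f} {c} {d} = coset-left a f c d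

  -- The diagonal entries of an item may be negative, whereas `weight` takes naturals. `A` and `D`
  -- are naturals with the same difference as the entries, which is all that the fixed point depends
  -- on besides `B` and `C`.
  record Weighted (p : ℕ × Mat) : Set where
    constructor weighted
    field
      {α δ′} : ℤ
      A D C B : ℕ
      shape  : proj₂ p ≡ mat α (- pos B) (pos C) δ′
      diff   : α - δ′ ≡ pos A - pos D
      value  : proj₁ p ≡ weight A D C B

  cmp-+ : ∀ k m n → cmp (k ℕ.+ m) (k ℕ.+ n) ≡ cmp m n
  cmp-+ zero m n = refl
  cmp-+ (suc k) m n = cmp-+ k m n

  weight-shift : ∀ k g c b → weight (k ℕ.+ g) k c b ≡ weight g 0 c b
  weight-shift k g c b = cong₂ (λ o o′ → weightTable o o′ (cmp c b)) (cmp-+ k g c)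
    (trans (cong₂ cmp (sym (ℕₚ.+-identityʳ k)) (ℕₚ.+-assoc k g c)) (cmp-+ k 0 (g ℕ.+ c)))

  weight-∣-∣ : ∀ a d c b → weight a d c b ≡ weight ℤ.∣ pos a - pos d ∣ 0 c b
  weight-∣-∣ a d c b with ℕₚ.≤-total d a
  ... | inj₁ d≤a with ℕₚ.m≤n⇒∃[o]m+o≡n d≤a
  ...   | g , refl = trans (weight-shift d g c b) (cong (λ e → weight ℤ.∣ e ∣ 0 c b) (eq′ (pos d) (pos g)))
    where
    eq′ : ∀ x y → y ≡ x + y - x
    eq′ x y = solve (x ∷ y ∷ [])
  weight-∣-∣ a d c b | inj₂ a≤d with ℕₚ.m≤n⇒∃[o]m+o≡n a≤d
  ...   | g , refl = trans (weight-comm a (a ℕ.+ g) c b) (trans (weight-shift a g c b)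
            (cong (λ h → weight h 0 c b) (trans (sym (ℤₚ.∣-i∣≡∣i∣ (pos g))) (cong ℤ.∣_∣ (eq′ (pos a) (pos g))))))
    where
    eq′ : ∀ x y → - y ≡ x - (x + y)
    eq′ x y = solve (x ∷ y ∷ [])

  weighted-χ : ∀ {p} → Weighted p → proj₁ p ≢ 0 → χM (proj₂ p) ≡ sixths (proj₁ p)
  weighted-χ (weighted A D zero B refl diff refl) k≢0 = ⊥-elim (k≢0 (weight-zero A D B))
  weighted-χ (weighted {α} {δ′} A D (suc k) B refl diff refl) _ =
    trans (χM-weight α δ′ k B)
      (cong sixths (trans (cong (λ e → weight ℤ.∣ e ∣ 0 (suc k) B) diff) (sym (weight-∣-∣ A D (suc k) B))))

  weighted-c>0 : ∀ {p} → Weighted p → proj₁ p ≢ 0 → 0ℤ ℤ.< c (proj₂ p)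
  weighted-c>0 (weighted A D zero B refl diff refl) k≢0 = ⊥-elim (k≢0 (weight-zero A D B))
  weighted-c>0 (weighted A D (suc k) B refl diff refl) _ = ℤ.+<+ z<s

  square-∣-∣ : ∀ i → i * i ≡ pos (ℤ.∣ i ∣ ℕ.* ℤ.∣ i ∣)
  square-∣-∣ (pos n) = sym (ℤₚ.pos-* n n)
  square-∣-∣ (-[1+ n ]) = refl

  -- The square of the trace minus four times the determinant is (α - δ′)² - 4BC. Nonzero weight
  -- gives ∣α - δ′∣ ≤ C ≤ B with C > 0, hence (α - δ′)² ≤ BC < 4BC.
  weighted-elliptic : ∀ {p} → Weighted p → proj₁ p ≢ 0 → Elliptic (proj₂ p)
  weighted-elliptic (weighted A D zero B refl diff refl) k≢0 = ⊥-elim (k≢0 (weight-zero A D B))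
  weighted-elliptic (weighted {α} {δ′} A D C@(suc k) B refl diff refl) k≢0 =
    subst₂ ℤ._<_ (lhs α δ′) (rhs α δ′ (pos B) (pos C)) (ℤₚ.+-monoʳ-< (pos 4 * (α * δ′)) e²<4BC)
    where
    g = ℤ.∣ α - δ′ ∣
    bounds = weight≢0⇒≤ {g} {0} {C} {B} (λ z → k≢0 (trans (weight-∣-∣ A D C B)
               (trans (cong (λ e → weight ℤ.∣ e ∣ 0 C B) (sym diff)) z)))
    g≤C : g ℕ.≤ C
    g≤C = proj₁ bounds
    C≤B : C ℕ.≤ B
    C≤B = proj₂ (proj₂ bounds)
    g²<4BC : g ℕ.* g ℕ.< 4 ℕ.* (B ℕ.* C)
    g²<4BC = ℕₚ.≤-<-trans (ℕₚ.≤-trans (ℕₚ.*-mono-≤ g≤C g≤C) (ℕₚ.*-monoˡ-≤ C C≤B))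
      (ℕₚ.m<m+n (B ℕ.* C) (ℕₚ.≤-trans (ℕₚ.≤-trans (s≤s z≤n) (ℕₚ.*-monoˡ-≤ C C≤B)) (ℕₚ.m≤m+n (B ℕ.* C) _)))
    e²<4BC : (α - δ′) * (α - δ′) ℤ.< pos 4 * (pos B * pos C)
    e²<4BC = subst₂ ℤ._<_ (sym (square-∣-∣ (α - δ′)))
      (trans (ℤₚ.pos-* 4 (B ℕ.* C)) (cong (pos 4 *_) (ℤₚ.pos-* B C))) (ℤ.+<+ g²<4BC)
    lhs : ∀ α δ′ → pos 4 * (α * δ′) + (α - δ′) * (α - δ′) ≡ (α + δ′) * (α + δ′)
    lhs α δ′ = solve (α ∷ δ′ ∷ [])
    rhs : ∀ α δ′ b c → pos 4 * (α * δ′) + pos 4 * (b * c) ≡ pos 4 * (α * δ′ - (- b) * c)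
    rhs α δ′ b c = solve (α ∷ δ′ ∷ b ∷ c ∷ [])

  diff-negated : ∀ x y → - x - - y ≡ y - x
  diff-negated x y = solve (x ∷ y ∷ [])

  weighted-items : ∀ s → All Weighted (items s)
  weighted-items s@(⟨ a , b , c , d ⟩) =
    weighted a d c b refl refl refl All.∷
    weighted c b d a refl (diff-negated (pos b) (pos c)) (weight-comm b c d a) All.∷
    third All.∷ All.[]
    where
    third : Weighted (diagonal s)
    third with b ℕ.<? a
    ... | yes _ = weighted (a ℕ.+ c) b (c ℕ.+ d) a refl (d₁ (pos a) (pos b) (pos c)) refl
      where
      d₁ : ∀ x y z → x - y - - z ≡ x + z - y
      d₁ x y z = solve (x ∷ y ∷ z ∷ [])
    ... | no _ = weighted a (b ℕ.+ d) (d ℕ.+ c) b refl (d₂ (pos a) (pos b) (pos d)) (weight-comm (b ℕ.+ d) a (d ℕ.+ c) b)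
      where
      d₂ : ∀ x y z → x - y - z ≡ x - (y + z)
      d₂ x y z = solve (x ∷ y ∷ z ∷ [])

-- Passing between matrices and states; distinctness and summation of the listed matrices.

module Items where
  open Weights
  open States
  open FixedPoints
  open Cosets
  open import Defs
  open import Data.Bool using (Bool; true; false)
  open import Data.Nat as ℕ using (ℕ; zero; suc; s≤s; z<s)
  import Data.Nat.Properties as ℕₚ
  open import Data.Nat.Tactic.RingSolver using () renaming (solve to solveℕ)
  open import Data.Integer as ℤ using (ℤ; -[1+_]; 0ℤ; 1ℤ; _+_; _*_; _-_; -_)
  import Data.Integer.Properties as ℤₚ
  open import Data.Integer.Tactic.RingSolver using (solve)
  open import Data.List using (List; []; _∷_; map)
  open import Data.List.Relation.Unary.All as All using (All)
  import Data.List.Relation.Unary.All.Properties as Allₚ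
  open import Data.List.Relation.Unary.AllPairs as AllPairs using (AllPairs)
  import Data.List.Relation.Unary.AllPairs.Properties as AllPairsₚ
  open import Data.List.Relation.Unary.Any using (here; there)
  open import Data.List.Membership.Propositional using (_∈_)
  open import Data.Rational as ℚ using (ℚ; toℚᵘ)
  import Data.Rational.Properties as ℚₚ
  open import Data.Rational.Unnormalised as ℚᵘ using (mkℚᵘ; *≡*)
  import Data.Rational.Unnormalised.Properties as ℚᵘₚ
  open import Data.Product using (Σ; _×_; _,_; proj₁; proj₂)
  open import Data.Sum using (_⊎_; inj₁; inj₂)
  open import Data.Empty
  open import Relation.Nullary using (¬_)
  open import Relation.Binary.PropositionalEquality

  -- The strict inequalities of the two half-open quadrants. `y₁ = 0` stays allowed, for the first
  -- two states of the chain, and strictness of `x₁` and `y₂` keeps the sign patterns of the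
  -- matrices apart.
  Valid : State → Set
  Valid s = 0 ℕ.< x₁ s × 0 ℕ.< y₂ s

  next-valid : ∀ s → Valid s → Valid (next s)
  next-valid ⟨ a , b , c , d ⟩ (p , q) with split a b
  ... | right {e} r rewrite next-right {e} {b} {c} {d} r = r , q
  ... | left {f = f} rewrite next-left {a} {f} {c} {d} = p , ℕₚ.m≤n⇒m≤o+n c q

  isPositive : ℤ → Bool
  isPositive (pos (suc _)) = true
  isPositive _ = false

  signs : Mat → Bool × Bool
  signs M = isPositive (a M) , isPositive (d M)

  -- Recovers the state of a matrix; the signs of the diagonal entries tell which of the three
  -- matrices of the state it is.
  decode : Mat → State
  decode M with signs M
  ... | true  , true  = ⟨ ℤ.∣ a M ∣ , ℤ.∣ b M ∣ , ℤ.∣ c M ∣ , ℤ.∣ d M ∣ ⟩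
  ... | false , false = ⟨ ℤ.∣ b M ∣ , ℤ.∣ a M ∣ , ℤ.∣ d M ∣ , ℤ.∣ c M ∣ ⟩
  ... | true  , false = ⟨ ℤ.∣ b M ∣ , ℤ.∣ b M ∣ ℕ.∸ ℤ.∣ a M ∣ , ℤ.∣ d M ∣ , ℤ.∣ c M ∣ ℕ.∸ ℤ.∣ d M ∣ ⟩
  ... | false , true  = ⟨ ℤ.∣ b M ∣ ℕ.∸ ℤ.∣ a M ∣ , ℤ.∣ b M ∣ , ℤ.∣ c M ∣ ℕ.∸ ℤ.∣ d M ∣ , ℤ.∣ d M ∣ ⟩

  isPositive-neg : ∀ n → isPositive (- pos n) ≡ false
  isPositive-neg zero = refl
  isPositive-neg (suc n) = refl

  isPositive-pos : ∀ {n} → 0 ℕ.< n → isPositive (pos n) ≡ true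
  isPositive-pos (s≤s _) = refl

  ∣-pos∣ : ∀ n → ℤ.∣ - pos n ∣ ≡ n
  ∣-pos∣ n = ℤₚ.∣-i∣≡∣i∣ (pos n)

  x+y-y : ∀ x y → x + y - y ≡ x
  x+y-y x y = solve (x ∷ y ∷ [])

  x-[y+x] : ∀ x y → x - (y + x) ≡ - y
  x-[y+x] x y = solve (x ∷ y ∷ [])

  diagonal-right′ : ∀ {e b c d} → 0 ℕ.< e → diagonal ⟨ e ℕ.+ b , b , c , d ⟩ ≡
    (weight (e ℕ.+ b ℕ.+ c) b (c ℕ.+ d) (e ℕ.+ b) , mat (pos e) (- pos (e ℕ.+ b)) (pos (c ℕ.+ d)) (- pos c))
  diagonal-right′ {e} {b} {c} {d} p = trans (diagonal-right p)
    (cong (λ x → weight (e ℕ.+ b ℕ.+ c) b (c ℕ.+ d) (e ℕ.+ b) , mat x (- pos (e ℕ.+ b)) (pos (c ℕ.+ d)) (- pos c)) (x+y-y (pos e) (pos b)))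

  diagonal-left′ : ∀ {a f c d} → diagonal ⟨ a , f ℕ.+ a , c , d ⟩ ≡
    (weight (f ℕ.+ a ℕ.+ d) a (d ℕ.+ c) (f ℕ.+ a) , mat (- pos f) (- pos (f ℕ.+ a)) (pos (d ℕ.+ c)) (pos d))
  diagonal-left′ {a} {f} {c} {d} = trans (diagonal-left {a} {f} {c} {d})
    (cong (λ x → weight (f ℕ.+ a ℕ.+ d) a (d ℕ.+ c) (f ℕ.+ a) , mat x (- pos (f ℕ.+ a)) (pos (d ℕ.+ c)) (pos d)) (x-[y+x] (pos a) (pos f)))

  decode-diagonal : ∀ s → Valid s → decode (proj₂ (diagonal s)) ≡ s
  decode-diagonal ⟨ a , b , c , d ⟩ (a>0 , d>0) with split a b
  ... | right {e} p rewrite diagonal-right′ {e} {b} {c} {d} p | isPositive-pos p | isPositive-neg c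
                          | ∣-pos∣ (e ℕ.+ b) | ∣-pos∣ c | ℕₚ.m+n∸m≡n e b | ℕₚ.m+n∸m≡n c d = refl
  ... | left {f = f} rewrite diagonal-left′ {a} {f} {c} {d} | isPositive-pos d>0 | isPositive-neg f
                          | ∣-pos∣ (f ℕ.+ a) | ∣-pos∣ f | ℕₚ.m+n∸m≡n f a | ℕₚ.m+n∸m≡n d c = refl

  decode-items : ∀ s → Valid s → All (λ p → decode (proj₂ p) ≡ s) (items s)
  decode-items s@(⟨ a , b , c , d ⟩) v@(a>0 , d>0) = basis≡ All.∷ rotated≡ All.∷ decode-diagonal s v All.∷ All.[]
    where
    basis≡ : decode (basis s) ≡ s
    basis≡ rewrite isPositive-pos a>0 | isPositive-pos d>0 | ∣-pos∣ b = refl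
    rotated≡ : decode (rotated s) ≡ s
    rotated≡ rewrite isPositive-neg b | isPositive-neg c | ∣-pos∣ a | ∣-pos∣ b | ∣-pos∣ c = refl

  signs-basis : ∀ s → Valid s → signs (basis s) ≡ (true , true)
  signs-basis s (p , q) = cong₂ _,_ (isPositive-pos p) (isPositive-pos q)

  signs-rotated : ∀ s → signs (rotated s) ≡ (false , false)
  signs-rotated s = cong₂ _,_ (isPositive-neg (x₂ s)) (isPositive-neg (y₁ s))

  signs-diagonal : ∀ s → Valid s →
    signs (proj₂ (diagonal s)) ≡ (true , false) ⊎ signs (proj₂ (diagonal s)) ≡ (false , true)
  signs-diagonal ⟨ a , b , c , d ⟩ (a>0 , d>0) with split a b
  ... | right {e} p rewrite diagonal-right′ {e} {b} {c} {d} p = inj₁ (cong₂ _,_ (isPositive-pos p) (isPositive-neg c))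
  ... | left {f = f} rewrite diagonal-left′ {a} {f} {c} {d} = inj₂ (cong₂ _,_ (isPositive-neg f) (isPositive-pos d>0))

  Distinct : ℕ × Mat → ℕ × Mat → Set
  Distinct p q = proj₂ p ≢ proj₂ q

  items-distinct : ∀ s → Valid s → AllPairs Distinct (items s)
  items-distinct s v =
    (basis≢rotated All.∷ basis≢diagonal All.∷ All.[]) AllPairs.∷
    (rotated≢diagonal All.∷ All.[]) AllPairs.∷ All.[] AllPairs.∷ AllPairs.[]
    where
    basis≢rotated : basis s ≢ rotated s
    basis≢rotated same with trans (sym (signs-basis s v)) (trans (cong signs same) (signs-rotated s))
    ... | ()
    basis≢diagonal : basis s ≢ proj₂ (diagonal s)
    basis≢diagonal same with signs-diagonal s v | trans (sym (signs-basis s v)) (cong signs same)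
    ... | inj₁ p | q with trans q p
    ...   | ()
    basis≢diagonal same | inj₂ p | q with trans q p
    ...   | ()
    rotated≢diagonal : rotated s ≢ proj₂ (diagonal s)
    rotated≢diagonal same with signs-diagonal s v | trans (sym (signs-rotated s)) (cong signs same)
    ... | inj₁ p | q with trans q p
    ...   | ()
    rotated≢diagonal same | inj₂ p | q with trans q p
    ...   | ()

  width height : State → ℕ
  width s = x₁ s ℕ.+ x₂ s
  height s = y₁ s ℕ.+ y₂ s

  -- Compares `height - width` without subtraction. Neither term alone is strictly monotone: the
  -- width stalls when `x₂ = 0`, the height when `y₁ = 0`.
  Ahead : State → State → Set
  Ahead s s′ = width s′ ℕ.+ height s ℕ.≤ width s ℕ.+ height s′

  next-ahead : ∀ s → Valid s → width (next s) ℕ.+ height s ℕ.< width s ℕ.+ height (next s)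
  next-ahead ⟨ a , b , c , d ⟩ (a>0 , d>0) with split a b
  ... | right {e} p rewrite next-right {e} {b} {c} {d} p = lin b d>0 (solveℕ (e ∷ b ∷ c ∷ d ∷ []))
  ... | left {f = f} rewrite next-left {a} {f} {c} {d} = lin c a>0 (solveℕ (a ∷ f ∷ c ∷ d ∷ []))

  ahead-next : ∀ s s′ → Valid s → Ahead (next s) s′ → Ahead s s′
  ahead-next s s′ v h = go (width s) (height s) (width (next s)) (height (next s)) (width s′) (height s′) h (ℕₚ.<⇒≤ (next-ahead s v))
    where
    go : ∀ w h nw nh w′ h′ → w′ ℕ.+ nh ℕ.≤ nw ℕ.+ h′ → nw ℕ.+ h ℕ.≤ w ℕ.+ nh → w′ ℕ.+ h ℕ.≤ w ℕ.+ h′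
    go w h nw nh w′ h′ p q = lin 0 (p ⊕ q) (solveℕ (w ∷ h ∷ nw ∷ nh ∷ w′ ∷ h′ ∷ []))

  trail-ahead : ∀ k s → Valid s → All (λ p → Ahead s (decode (proj₂ p))) (trail k s)
  trail-ahead zero s v = All.[]
  trail-ahead (suc k) s v = Allₚ.++⁺
    (All.map (λ e → subst (Ahead s) (sym e) ℕₚ.≤-refl) (decode-items s v))
    (All.map (λ {p} h → ahead-next s (decode (proj₂ p)) v h) (trail-ahead k (next s) (next-valid s v)))

  -- Equal matrices decode to the same state, and along the chain `height - width` strictly
  -- increases.
  trail-distinct : ∀ k s → Valid s → AllPairs Distinct (trail k s)
  trail-distinct zero s v = AllPairs.[]
  trail-distinct (suc k) s v = AllPairsₚ.++⁺ (items-distinct s v) (trail-distinct k (next s) v′)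
    (All.map (λ {p} e → All.map (λ {q} h → λ p≡q → separate p q e h p≡q) (trail-ahead k (next s) v′)) (decode-items s v))
    where
    v′ = next-valid s v
    separate : ∀ p q → decode (proj₂ p) ≡ s → Ahead (next s) (decode (proj₂ q)) → proj₂ p ≢ proj₂ q
    separate p q e h p≡q = ℕₚ.<⇒≱ (next-ahead s v)
      (subst (Ahead (next s)) (trans (cong decode (sym p≡q)) e) h)

  trail-weighted : ∀ k s → All Weighted (trail k s)
  trail-weighted zero s = All.[]
  trail-weighted (suc k) s = Allₚ.++⁺ (weighted-items s) (trail-weighted k (next s))

  items-coset : ∀ s → All (λ p → InCoset (basis s) (proj₂ p)) (items s)
  items-coset s@(⟨ _ , _ , _ , _ ⟩) =
    (scalar 1ℤ , refl , ·-identityʳ (basis s)) All.∷ coset-rotated s All.∷ coset-diagonal s All.∷ All.[]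

  trail-coset : ∀ M₀ k s → InCoset M₀ (basis s) → All (λ p → InCoset M₀ (proj₂ p)) (trail k s)
  trail-coset M₀ zero s h = All.[]
  trail-coset M₀ (suc k) s h = Allₚ.++⁺ (All.map (λ {p} → coset-trans M₀ (basis s) (proj₂ p) h) (items-coset s))
    (trail-coset M₀ k (next s) (coset-trans M₀ (basis s) (basis (next s)) h (coset-next s)))

  -- Items of weight 0 add nothing to the sum and may fail to be elliptic, as those with `c = 0` do.
  support : List (ℕ × Mat) → List Mat
  support [] = []
  support ((zero , _) ∷ l) = support l
  support ((suc _ , M) ∷ l) = M ∷ support l

  support-All : ∀ {P : Mat → Set} {l} → All (λ p → proj₁ p ≢ 0 → P (proj₂ p)) l → All P (support l)
  support-All All.[] = All.[]
  support-All {l = (zero , _) ∷ _} (_ All.∷ h) = support-All h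
  support-All {l = (suc _ , _) ∷ _} (p All.∷ h) = p (λ ()) All.∷ support-All h

  support-∈ : ∀ {p l} → p ∈ l → proj₁ p ≢ 0 → proj₂ p ∈ support l
  support-∈ {zero , _} _ k≢0 = ⊥-elim (k≢0 refl)
  support-∈ {suc _ , _} (here refl) _ = here refl
  support-∈ {suc _ , _} {(zero , _) ∷ _} (there h) k≢0 = support-∈ h k≢0
  support-∈ {suc _ , _} {(suc _ , _) ∷ _} (there h) k≢0 = there (support-∈ h k≢0)

  -- Nonzero weight makes the lower left entry positive in both matrices, so neither is the negative
  -- of the other.
  ≉± : ∀ {p q} → Weighted p → Weighted q → proj₁ p ≢ 0 → proj₁ q ≢ 0 → Distinct p q → ¬ (proj₂ p ≈± proj₂ q)
  ≉± _ _ _ _ p≢q (inj₁ p≡q) = p≢q p≡q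
  ≉± {p} {q} wp wq kp kq _ (inj₂ p≡-q) = ℤₚ.<-asym (weighted-c>0 wp kp)
    (subst (ℤ._< 0ℤ) (sym (cong c p≡-q)) (ℤₚ.neg-mono-< (weighted-c>0 wq kq)))

  support-distinct : ∀ {l} → All Weighted l → AllPairs Distinct l → AllPairs (λ M N → ¬ (M ≈± N)) (support l)
  support-distinct {[]} _ _ = AllPairs.[]
  support-distinct {(zero , _) ∷ _} (_ All.∷ w) (_ AllPairs.∷ h) = support-distinct w h
  support-distinct {(suc _ , _) ∷ _} (wp All.∷ w) (hp AllPairs.∷ h) =
    support-All (All.zipWith (λ (wq , p≢q) kq → ≉± wp wq (λ ()) kq p≢q) (w , hp)) AllPairs.∷ support-distinct w h

  sixths-+ : ∀ m n → sixths (m ℕ.+ n) ≡ sixths m ℚ.+ sixths n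
  sixths-+ m n = ℚₚ.toℚᵘ-injective (begin
    toℚᵘ (sixths (m ℕ.+ n))               ≈⟨ ℚₚ.toℚᵘ-fromℚᵘ (mkℚᵘ (pos (m ℕ.+ n)) 5) ⟩
    mkℚᵘ (pos m + pos n) 5                 ≈⟨ *≡* (identity (pos m) (pos n)) ⟩
    mkℚᵘ (pos m) 5 ℚᵘ.+ mkℚᵘ (pos n) 5     ≈⟨ ℚᵘₚ.+-cong (ℚₚ.toℚᵘ-fromℚᵘ (mkℚᵘ (pos m) 5)) (ℚₚ.toℚᵘ-fromℚᵘ (mkℚᵘ (pos n) 5)) ⟨
    toℚᵘ (sixths m) ℚᵘ.+ toℚᵘ (sixths n)   ≈⟨ ℚₚ.toℚᵘ-homo-+ (sixths m) (sixths n) ⟨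
    toℚᵘ (sixths m ℚ.+ sixths n) ∎)
    where
    open ℚᵘₚ.≃-Reasoning
    identity : ∀ x y → (x + y) * pos 36 ≡ (x * pos 6 + y * pos 6) * pos 6
    identity x y = solve (x ∷ y ∷ [])

  support-sum : ∀ {l} → All Weighted l → sumℚ (map χM (support l)) ≡ sixths (totalWeight l)
  support-sum {[]} _ = refl
  support-sum {(zero , _) ∷ _} (_ All.∷ h) = support-sum h
  support-sum {(k@(suc _) , _) ∷ l} (w All.∷ h) =
    trans (cong₂ ℚ._+_ (weighted-χ w (λ ())) (support-sum h)) (sym (sixths-+ k (totalWeight l)))

  data SignView : ℤ → Set where
    positive : ∀ n → SignView (pos (suc n))
    nonpositive : ∀ n → SignView (- pos n)

  signView : ∀ i → SignView i
  signView (pos zero) = nonpositive 0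
  signView (pos (suc n)) = positive n
  signView -[1+ n ] = nonpositive (suc n)

  weight-nonzero : ∀ {α δ A D C B} → α - δ ≡ pos A - pos D → weight ℤ.∣ α - δ ∣ 0 C B ≢ 0 → weight A D C B ≢ 0
  weight-nonzero {A = A} {D} {C} {B} e h z =
    h (trans (cong (λ x → weight ℤ.∣ x ∣ 0 C B) e) (trans (sym (weight-∣-∣ A D C B)) z))

  weight≢0⇒c>0 : ∀ {a d c b} → weight a d c b ≢ 0 → 0 ℕ.< c
  weight≢0⇒c>0 {a} {d} {zero} {b} h = ⊥-elim (h (weight-zero a d b))
  weight≢0⇒c>0 {c = suc _} _ = z<s

  Located : Mat → Set
  Located M = Σ State λ s → Valid s × Σ ℕ λ k → ((k , M) ∈ items s) × k ≢ 0

  -- The signs of `α` and `δ` tell which of the three matrices is at hand. Nonzero weight gives ∣α -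
  -- δ∣ ≤ C ≤ B, and these bounds keep the entries of the state natural when the multiplication is
  -- undone.
  locate : ∀ α δ B C → weight ℤ.∣ α - δ ∣ 0 C B ≢ 0 → Located (mat α (- pos B) (pos C) δ)
  locate α δ B C h with signView α | signView δ
  ... | positive a | positive d =
    ⟨ suc a , B , C , suc d ⟩ , (z<s , z<s) , weight (suc a) (suc d) C B , here refl ,
    weight-nonzero {pos (suc a)} {pos (suc d)} {suc a} {suc d} {C} {B} refl h
  ... | nonpositive b | nonpositive c =
    ⟨ B , b , c , C ⟩ , (ℕₚ.≤-trans C>0 C≤B , C>0) , weight b c C B , there (here refl) ,
    (λ z → weight-nonzero { - pos b} { - pos c} {c} {b} {C} {B} (diff-negated (pos b) (pos c)) h (trans (weight-comm c b C B) z))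
    where
    C>0 = weight≢0⇒c>0 {ℤ.∣ - pos b - - pos c ∣} {0} {C} {B} h
    C≤B : C ℕ.≤ B
    C≤B = proj₂ (proj₂ (weight≢0⇒≤ {ℤ.∣ - pos b - - pos c ∣} {0} {C} {B} h))
  ... | positive e | nonpositive c = found
    where
    diff₀ : pos (suc e) - - pos c ≡ pos (suc e ℕ.+ c)
    diff₀ = cong (pos (suc e) +_) (ℤₚ.neg-involutive (pos c))
    bounds = weight≢0⇒≤ {suc e ℕ.+ c} {0} {C} {B} (subst (λ i → weight ℤ.∣ i ∣ 0 C B ≢ 0) diff₀ h)
    e+c≤C : suc e ℕ.+ c ℕ.≤ C
    e+c≤C = proj₁ bounds
    C≤B : C ℕ.≤ B
    C≤B = proj₂ (proj₂ bounds)
    diff₁ : ∀ x y z → x - - z ≡ x + y + z - y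
    diff₁ x y z = solve (x ∷ y ∷ z ∷ [])
    found : Located (mat (pos (suc e)) (- pos B) (pos C) (- pos c))
    found with ℕₚ.m≤n⇒∃[o]m+o≡n (ℕₚ.m+n≤o⇒n≤o (suc e) e+c≤C)
             | ℕₚ.m≤n⇒∃[o]m+o≡n (ℕₚ.≤-trans (ℕₚ.m+n≤o⇒m≤o (suc e) e+c≤C) C≤B)
    -- The state is recovered from `C = c + d` and `B = suc e + b`; the strip bound `suc e + c ≤ C`
    -- makes `d` positive.
    ... | d , refl | b , refl =
      ⟨ suc e ℕ.+ b , b , c , d ⟩ , (z<s , ℕₚ.≤-trans (z<s {e}) (ℕₚ.+-cancelˡ-≤ c (suc e) d (subst (ℕ._≤ c ℕ.+ d) (ℕₚ.+-comm (suc e) c) e+c≤C))) ,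
      weight (suc e ℕ.+ b ℕ.+ c) b (c ℕ.+ d) (suc e ℕ.+ b) , there (there (here (sym (diagonal-right′ {suc e} {b} {c} {d} z<s)))) ,
      weight-nonzero {pos (suc e)} { - pos c} {suc e ℕ.+ b ℕ.+ c} {b} {c ℕ.+ d} {suc e ℕ.+ b} (diff₁ (pos (suc e)) (pos b) (pos c)) h
  locate α δ B C h | nonpositive f | positive d = found
    where
    diff₀ : - pos f - pos (suc d) ≡ - pos (suc d ℕ.+ f)
    diff₀ = sum-neg (pos f) (pos (suc d))
      where
      sum-neg : ∀ x y → - x - y ≡ - (y + x)
      sum-neg x y = solve (x ∷ y ∷ [])
    bounds = weight≢0⇒≤ {suc d ℕ.+ f} {0} {C} {B} (subst (λ n → weight n 0 C B ≢ 0) (trans (cong ℤ.∣_∣ diff₀) (∣-pos∣ (suc d ℕ.+ f))) h)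
    d+f≤C : suc d ℕ.+ f ℕ.≤ C
    d+f≤C = proj₁ bounds
    C≤B : C ℕ.≤ B
    C≤B = proj₂ (proj₂ bounds)
    diff₁ : ∀ x y z → - x - z ≡ y - (x + y + z)
    diff₁ x y z = solve (x ∷ y ∷ z ∷ [])
    found : Located (mat (- pos f) (- pos B) (pos C) (pos (suc d)))
    found with ℕₚ.m≤n⇒∃[o]m+o≡n (ℕₚ.m+n≤o⇒m≤o (suc d) d+f≤C)
             | ℕₚ.m≤n⇒∃[o]m+o≡n (ℕₚ.≤-trans (ℕₚ.m+n≤o⇒n≤o (suc d) d+f≤C) C≤B)
    ... | c , refl | a , refl =
      ⟨ a , f ℕ.+ a , c , suc d ⟩ , (ℕₚ.≤-trans (z<s {d}) (ℕₚ.+-cancelˡ-≤ f (suc d) a (subst (ℕ._≤ f ℕ.+ a) (ℕₚ.+-comm (suc d) f) (ℕₚ.≤-trans d+f≤C C≤B))) , z<s) ,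
      weight (f ℕ.+ a ℕ.+ suc d) a (suc d ℕ.+ c) (f ℕ.+ a) , there (there (here (sym (diagonal-left′ {a} {f} {c} {suc d})))) ,
      (λ z → weight-nonzero { - pos f} {pos (suc d)} {a} {f ℕ.+ a ℕ.+ suc d} {suc d ℕ.+ c} {f ℕ.+ a} (diff₁ (pos f) (pos a) (pos (suc d))) h
        (trans (weight-comm a (f ℕ.+ a ℕ.+ suc d) (suc d ℕ.+ c) (f ℕ.+ a)) z))

-- Every state of the coset lies on the chain or carries no weight.

module Reachability where
  open Weights
  open States
  open FixedPoints
  open Cosets
  open Items
  open import Defs
  open import Data.Nat as ℕ using (ℕ; zero; suc; z<s)
  import Data.Nat.Properties as ℕₚ
  open import Data.Nat.Tactic.RingSolver using () renaming (solve to solveℕ)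
  open import Data.Integer as ℤ using (ℤ; -[1+_]; 0ℤ; 1ℤ; _+_; _*_; _-_; -_)
  import Data.Integer.Properties as ℤₚ
  open import Data.Integer.Tactic.RingSolver using (solve)
  open import Data.List using ([]; _∷_)
  open import Data.List.Relation.Unary.Any using (here; there)
  open import Data.List.Membership.Propositional using (_∈_)
  open import Data.List.Membership.Propositional.Properties using (∈-++⁺ˡ; ∈-++⁺ʳ)
  open import Data.Product using (Σ; ∃; _×_; _,_; proj₁)
  open import Data.Sum using (_⊎_; inj₁; inj₂)
  open import Data.Empty
  open import Relation.Nullary using (no)
  open import Relation.Binary.PropositionalEquality

  weightless : ∀ {p} l → totalWeight l ≡ 0 → p ∈ l → proj₁ p ≡ 0
  weightless (p ∷ l) h (here refl) = ℕₚ.m+n≡0⇒m≡0 (proj₁ p) h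
  weightless (p ∷ l) h (there q) = weightless l (ℕₚ.m+n≡0⇒n≡0 (proj₁ p) h) q

  -- By `Φ-next` the potential splits into natural numbers, so if it is 0 then every weight from
  -- there on is 0. This is why a finite trail misses nothing.
  Φ≡0⇒weightless : ∀ k s {p} → Positive s → Φ s ≡ 0 → p ∈ items (iterate k s) → proj₁ p ≡ 0
  Φ≡0⇒weightless zero s s>0 Φ≡0 h =
    weightless (items s) (ℕₚ.m+n≡0⇒m≡0 (totalWeight (items s)) (trans (sym (Φ-next s s>0)) Φ≡0)) h
  Φ≡0⇒weightless (suc k) s s>0 Φ≡0 h = Φ≡0⇒weightless k (next s) (next-positive s s>0)
    (ℕₚ.m+n≡0⇒n≡0 (totalWeight (items s)) (trans (sym (Φ-next s s>0)) Φ≡0)) h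

  ∈-trail : ∀ n k s {p} → Positive s → Φ (iterate n s) ≡ 0 → p ∈ items (iterate k s) → proj₁ p ≢ 0 → p ∈ trail n s
  ∈-trail zero k s s>0 Φ≡0 h p≢0 = ⊥-elim (p≢0 (Φ≡0⇒weightless k s s>0 Φ≡0 h))
  ∈-trail (suc n) zero s s>0 Φ≡0 h p≢0 = ∈-++⁺ˡ h
  ∈-trail (suc n) (suc k) s s>0 Φ≡0 h p≢0 =
    ∈-++⁺ʳ (items s) (∈-trail n k (next s) (next-positive s s>0) Φ≡0 h p≢0)

  iterate-suc : ∀ k s → iterate (suc k) s ≡ next (iterate k s)
  iterate-suc zero s = refl
  iterate-suc (suc k) s = iterate-suc k (next s)

  -pos≢suc : ∀ m {n} → - pos m ≢ pos (suc n)
  -pos≢suc zero ()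
  -pos≢suc (suc m) ()

  -- The zero in the lower left forces `r = 0`, hence `p * s = 1`; positivity of `D` and `d₀`
  -- excludes the sign -1. Only a unipotent matrix is left, which shifts `X` by a multiple of `A`.
  upper : ∀ {A D a₀ d₀ X Y} → 0 ℕ.< D → 0 ℕ.< d₀ →
    InCoset (mat (pos A) X 0ℤ (pos D)) (mat (pos a₀) Y 0ℤ (pos d₀)) →
    a₀ ≡ A × d₀ ≡ D × Σ ℤ λ q → Y ≡ X + pos A * q
  upper {A} {D@(suc _)} {a₀} {d₀@(suc _)} {X} {Y} D>0 d₀>0 (mat p q r s , det≡1 , eqn) = result (signView s) refl
    where
    r≡0 : r ≡ 0ℤ
    r≡0 with ℤₚ.i*j≡0⇒i≡0∨j≡0 (pos D) (trans (sym (0*x+y p (pos D * r))) (cong c eqn))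
    ... | inj₂ z = z
    Ds≡d₀ : pos D * s ≡ pos d₀
    Ds≡d₀ = trans (sym (0*x+y q (pos D * s))) (cong d eqn)
    ps≡1 : p * s ≡ 1ℤ
    ps≡1 = trans (drop p s q) (subst (λ r → p * s - q * r ≡ 1ℤ) r≡0 det≡1)
      where
      drop : ∀ p s q → p * s ≡ p * s - q * 0ℤ
      drop p s q = solve (p ∷ s ∷ q ∷ [])
    result : ∀ {t} → SignView t → s ≡ t → a₀ ≡ A × d₀ ≡ D × Σ ℤ λ q → Y ≡ X + pos A * q
    result (nonpositive n) s≡ = ⊥-elim (-pos≢suc (D ℕ.* n)
      (trans (cong -_ (ℤₚ.pos-* D n)) (trans (ℤₚ.neg-distribʳ-* (pos D) (pos n)) (subst (λ s → pos D * s ≡ pos d₀) s≡ Ds≡d₀))))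
    result (positive n) s≡ =
        ℤₚ.+-injective (trans (sym (cong a eqn)) (trans (cong₂ (λ p r → pos A * p + X * r) p≡1 r≡0) (x*1+y*0 (pos A) X)))
      , ℤₚ.+-injective (trans (sym Ds≡d₀) (trans (cong (pos D *_) s≡1) (ℤₚ.*-identityʳ (pos D))))
      , q , trans (sym (cong b eqn)) (trans (cong (λ s → pos A * q + X * s) s≡1) (x*y+z*1 (pos A) q X))
      where
      s≡1 : s ≡ 1ℤ
      s≡1 = trans s≡ (cong pos (trans (cong ℤ.∣_∣ (sym s≡))
        (ℕₚ.m*n≡1⇒n≡1 ℤ.∣ p ∣ ℤ.∣ s ∣ (trans (sym (ℤₚ.abs-* p s)) (cong ℤ.∣_∣ ps≡1)))))
      p≡1 : p ≡ 1ℤ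
      p≡1 = trans (sym (ℤₚ.*-identityʳ p)) (trans (cong (p *_) (sym s≡1)) ps≡1)

  -- One step before the Hermite normal form: in the root coset this state still carries a corner.
  start : ℕ → ℕ → ℕ → State
  start A β D = ⟨ A , β ℕ.+ A , 0 , D ⟩

  -- The chain extends backwards through (a , b + k a , 0 , d) for all k, but these states have no weight.
  Shore : State → Set
  Shore s = y₁ s ≡ 0 × 2 ℕ.* x₁ s ℕ.≤ x₂ s

  shore-weightless : ∀ s → Valid s → Shore s → totalWeight (items s) ≡ 0
  shore-weightless ⟨ a , b , _ , d ⟩ (a>0 , d>0) (refl , h) with split a b
  ... | right {e} p = ⊥-elim (ℕₚ.<-irrefl {0} refl (lin (e ℕ.+ b) (h ⊕ p) (solveℕ (e ∷ b ∷ []))))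
  ... | left {f = f} = trans (items-left a f 0 d) (cong₂ ℕ._+_ (cong₂ ℕ._+_ first (weight-zero a d (f ℕ.+ a)))
      (weight-outside {f ℕ.+ a ℕ.+ d} {a} {d ℕ.+ 0} {f ℕ.+ a} (lin 0 (h ⊕ a>0) (solveℕ (f ∷ a ∷ d ∷ [])))))
    where
    first : weight (f ℕ.+ a) 0 d a ≡ 0
    first with ℕₚ.<-≤-connex a d
    ... | inj₁ p = weight-below {f ℕ.+ a} {0} {d} {a} p
    ... | inj₂ p = weight-outside {f ℕ.+ a} {0} {d} {a} (lin 0 (h ⊕ p ⊕ a>0) (solveℕ (f ∷ a ∷ d ∷ [])))

  next-shore : ∀ s → Valid s → Shore s → y₁ (next s) ≡ 0
  next-shore ⟨ a , b , _ , d ⟩ (a>0 , d>0) (refl , h) with split a b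
  ... | right {e} p = ⊥-elim (ℕₚ.<-irrefl {0} refl (lin (e ℕ.+ b) (h ⊕ p) (solveℕ (e ∷ b ∷ []))))
  ... | left {f = f} rewrite next-left {a} {f} {0} {d} = refl

  -- Here `b = β + A - A * q` for an integer q. The values 0 and 1 give the start and its successor,
  -- larger ones would make `b` negative, and negative ones give `b ≥ 2 * A`, the shore.
  reach-shore : ∀ {A β D} → 0 ℕ.< D → β ℕ.< A → ∀ a b d → 0 ℕ.< d →
    InCoset (basis (start A β D)) (basis ⟨ a , b , 0 , d ⟩) →
    (∃ λ k → ⟨ a , b , 0 , d ⟩ ≡ iterate k (start A β D)) ⊎ Shore ⟨ a , b , 0 , d ⟩
  reach-shore {A} {β} {D} D>0 β<A a b d d>0 h with upper {A} {D} {a} {d} { - pos (β ℕ.+ A)} { - pos b} D>0 d>0 h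
  ... | refl , refl , pos q , e = go q sumℕ
    where
    move : ∀ x y z → z ≡ - x + y → - z + y ≡ x
    move x y z e = trans (cong (λ z → - z + y) e) (solve (x ∷ y ∷ []))
    sumℕ : b ℕ.+ A ℕ.* q ≡ β ℕ.+ A
    sumℕ = ℤₚ.+-injective (trans (cong (pos b +_) (ℤₚ.pos-* A q))
      (trans (cong (_+ pos A * pos q) (sym (ℤₚ.neg-involutive (pos b)))) (move (pos (β ℕ.+ A)) (pos A * pos q) (- pos b) e)))
    go : ∀ q → b ℕ.+ A ℕ.* q ≡ β ℕ.+ A → (∃ λ k → ⟨ A , b , 0 , D ⟩ ≡ iterate k (start A β D)) ⊎ Shore ⟨ A , b , 0 , D ⟩
    go 0 e = inj₁ (0 , cong (λ b → ⟨ A , b , 0 , D ⟩) (trans (sym (trans (cong (b ℕ.+_) (ℕₚ.*-zeroʳ A)) (ℕₚ.+-identityʳ b))) e))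
    go 1 e = inj₁ (1 , trans (cong (λ b → ⟨ A , b , 0 , D ⟩)
      (ℕₚ.+-cancelʳ-≡ A b β (trans (cong (b ℕ.+_) (sym (ℕₚ.*-identityʳ A))) e))) (sym (next-left {A} {β} {0} {D})))
    go (suc (suc m)) e = ⊥-elim (ℕₚ.<-irrefl {0} refl
      (lin (b ℕ.+ A ℕ.* m) (ℕₚ.≤-reflexive e ⊕ β<A) (solveℕ (b ∷ A ∷ m ∷ β ∷ []))))
  ... | refl , refl , -[1+ m ] , e = inj₂ (refl , lin (β ℕ.+ A ℕ.* m) (ℕₚ.≤-reflexive (sym b≡)) (solveℕ (b ∷ A ∷ m ∷ β ∷ [])))
    where
    move : ∀ x y → - (- x - y) ≡ x + y
    move x y = solve (x ∷ y ∷ [])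
    b≡ : b ≡ β ℕ.+ A ℕ.+ A ℕ.* suc m
    b≡ = ℤₚ.+-injective (trans (sym (ℤₚ.neg-involutive (pos b))) (trans (cong -_ e)
      (trans (cong (λ x → - (- pos (β ℕ.+ A) + x)) (sym (ℤₚ.neg-distribʳ-* (pos A) (pos (suc m)))))
        (trans (move (pos (β ℕ.+ A)) (pos A * pos (suc m))) (cong (pos (β ℕ.+ A) +_) (sym (ℤₚ.pos-* A (suc m))))))))

  -- Descent: while `c > 0`, comparing `c` with `d` reveals which branch of `next` led here, and
  -- undoing it lowers the height. The predecessor cannot be on the shore, since successors of shore
  -- states have `c = 0`.
  reach : ∀ {A β D} → 0 ℕ.< D → β ℕ.< A → ∀ n s → Valid s → height s ℕ.≤ n →
    InCoset (basis (start A β D)) (basis s) → (∃ λ k → s ≡ iterate k (start A β D)) ⊎ Shore s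
  reach D>0 β<A n ⟨ a , b , zero , d ⟩ (a>0 , d>0) _ h = reach-shore D>0 β<A a b d d>0 h
  reach D>0 β<A zero ⟨ a , b , suc c , d ⟩ (a>0 , d>0) () h
  -- The tie `c = d` belongs to the branch that subtracts `d` from `c`: the predecessor may have
  -- `c = 0`, but its `d` must stay positive.
  reach {A} {β} {D} D>0 β<A (suc n) ⟨ a , b , c@(suc _) , d ⟩ (a>0 , d>0) c+d≤n h with ℕₚ.<-≤-connex c d
  ... | inj₂ d≤c with ℕₚ.m≤n⇒∃[o]m+o≡n d≤c
  ...   | c′ , d+c′≡c = extend
      (reach D>0 β<A n pred valid
        (ℕₚ.≤-trans (ℕₚ.≤-reflexive (trans (ℕₚ.+-comm c′ d) d+c′≡c)) (ℕₚ.≤-pred (ℕₚ.≤-trans (ℕₚ.m<m+n c d>0) c+d≤n)))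
        (coset-trans (basis (start A β D)) (basis ⟨ a , b , c , d ⟩) (basis pred) h
          (coset-sym (basis pred) (basis ⟨ a , b , c , d ⟩) (subst (λ s → InCoset (basis pred) (basis s)) next≡ (coset-next pred)))))
    where
    pred = ⟨ a ℕ.+ b , b , c′ , d ⟩
    valid : Valid pred
    valid = ℕₚ.m≤n⇒m≤n+o b a>0 , d>0
    next≡ : next pred ≡ ⟨ a , b , c , d ⟩
    next≡ = trans (next-right {a} {b} {c′} {d} a>0) (cong (λ c → ⟨ a , b , c , d ⟩) (trans (ℕₚ.+-comm c′ d) d+c′≡c))
    extend : (∃ λ k → pred ≡ iterate k (start A β D)) ⊎ Shore pred →
      (∃ λ k → ⟨ a , b , c , d ⟩ ≡ iterate k (start A β D)) ⊎ Shore ⟨ a , b , c , d ⟩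
    extend (inj₁ (k , e)) = inj₁ (suc k , trans (sym next≡) (trans (cong next e) (sym (iterate-suc k (start A β D)))))
    extend (inj₂ sh) with trans (sym (cong y₁ next≡)) (next-shore pred valid sh)
    ... | ()
  reach {A} {β} {D} D>0 β<A (suc n) ⟨ a , b , c@(suc _) , d ⟩ (a>0 , d>0) c+d≤n h | inj₁ c<d with ℕₚ.m≤n⇒∃[o]m+o≡n (ℕₚ.<⇒≤ c<d)
  ...   | d′ , c+d′≡d = extend
      (reach D>0 β<A n pred valid
        (ℕₚ.≤-trans (ℕₚ.≤-reflexive c+d′≡d) (ℕₚ.≤-pred (ℕₚ.≤-trans (ℕₚ.m<n+m d z<s) c+d≤n)))
        (coset-trans (basis (start A β D)) (basis ⟨ a , b , c , d ⟩) (basis pred) h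
          (coset-sym (basis pred) (basis ⟨ a , b , c , d ⟩) (subst (λ s → InCoset (basis pred) (basis s)) next≡ (coset-next pred)))))
    where
    pred = ⟨ a , b ℕ.+ a , c , d′ ⟩
    valid : Valid pred
    valid = a>0 , ℕₚ.+-cancelˡ-< c 0 d′ (subst₂ ℕ._<_ (sym (ℕₚ.+-identityʳ c)) (sym c+d′≡d) c<d)
    next≡ : next pred ≡ ⟨ a , b , c , d ⟩
    next≡ = trans (next-left {a} {b} {c} {d′}) (cong (λ d → ⟨ a , b , c , d ⟩) c+d′≡d)
    extend : (∃ λ k → pred ≡ iterate k (start A β D)) ⊎ Shore pred →
      (∃ λ k → ⟨ a , b , c , d ⟩ ≡ iterate k (start A β D)) ⊎ Shore ⟨ a , b , c , d ⟩
    extend (inj₁ (k , e)) = inj₁ (suc k , trans (sym next≡) (trans (cong next e) (sym (iterate-suc k (start A β D)))))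
    extend (inj₂ sh) with trans (sym (cong y₁ next≡)) (next-shore pred valid sh)
    ... | ()

-- Hermite normal form, the finite enumeration, and the value of the sum.

module Assembly where
  open Weights
  open States
  open FixedPoints
  open Cosets
  open Items
  open Reachability
  open import Defs
  open import Data.Nat as ℕ using (ℕ; zero; suc; z<s)
  import Data.Nat.Properties as ℕₚ
  open import Data.Nat.Divisibility using (divides)
  open import Data.Nat.GCD using (gcd; gcd[m,n]∣m; gcd[m,n]∣n; gcd-GCD; module Bézout)
  open import Data.Nat.Tactic.RingSolver using () renaming (solve to solveℕ)
  open import Data.Integer as ℤ using (ℤ; -[1+_]; 0ℤ; 1ℤ; -1ℤ; _+_; _*_; _-_; -_)
  import Data.Integer.Properties as ℤₚ
  open import Data.Integer.DivMod using (_/ℕ_; _%ℕ_; a≡a%ℕn+[a/ℕn]*n; n%ℕd<d)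
  open import Data.Integer.Tactic.RingSolver using (solve)
  open import Data.List using (List; []; _∷_; _++_; map)
  open import Data.List.Relation.Unary.All as All using (All)
  open import Data.List.Relation.Unary.AllPairs using (AllPairs)
  open import Data.List.Relation.Unary.Any as Any using (Any)
  open import Data.List.Membership.Propositional using (_∈_)
  open import Data.List.Membership.Propositional.Properties using (∈-++⁺ˡ; ∈-++⁺ʳ)
  open import Data.Rational as ℚ using (ℚ; 0ℚ; 1ℚ)
  open import Data.Product using (Σ; ∃; _×_; _,_; proj₁; proj₂)
  open import Data.Sum using (_⊎_; inj₁; inj₂)
  open import Data.Empty
  open import Function using (_∘_)
  open import Relation.Nullary using (¬_)
  open import Relation.Nullary.Decidable using (dec-true; dec-false)
  open import Relation.Binary.Definitions using (Tri; tri<; tri≈; tri>)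
  open import Relation.Binary.PropositionalEquality

  sign-abs : ∀ i → Σ ℤ λ ε → ε * ε ≡ 1ℤ × i ≡ ε * pos ℤ.∣ i ∣
  sign-abs (pos n) = 1ℤ , refl , sym (ℤₚ.*-identityˡ (pos n))
  sign-abs -[1+ n ] = -1ℤ , refl , sym (ℤₚ.-1*i≡-i (pos (suc n)))

  bézout-gcd : ∀ m n → Σ ℤ λ u → Σ ℤ λ v → pos m * u + pos n * v ≡ pos (gcd m n)
  bézout-gcd m n with Bézout.identity (gcd-GCD m n)
  ... | Bézout.+- x y e = pos x , - pos y , (begin
      pos m * pos x + pos n * - pos y                   ≡⟨ arrange (pos m) (pos x) (pos n) (pos y) ⟩
      pos x * pos m - pos y * pos n                     ≡⟨ cong₂ _-_ (ℤₚ.pos-* x m) (ℤₚ.pos-* y n) ⟨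
      pos (x ℕ.* m) - pos (y ℕ.* n)                     ≡⟨ cong (λ z → pos z - pos (y ℕ.* n)) e ⟨
      pos (gcd m n) + pos (y ℕ.* n) - pos (y ℕ.* n)     ≡⟨ x+y-y (pos (gcd m n)) (pos (y ℕ.* n)) ⟩
      pos (gcd m n) ∎)
    where
    open ≡-Reasoning
    arrange : ∀ m x n y → m * x + n * - y ≡ x * m - y * n
    arrange m x n y = solve (m ∷ x ∷ n ∷ y ∷ [])
  ... | Bézout.-+ x y e = - pos x , pos y , (begin
      pos m * - pos x + pos n * pos y                   ≡⟨ arrange (pos m) (pos x) (pos n) (pos y) ⟩
      pos y * pos n - pos x * pos m                     ≡⟨ cong₂ _-_ (ℤₚ.pos-* y n) (ℤₚ.pos-* x m) ⟨
      pos (y ℕ.* n) - pos (x ℕ.* m)                     ≡⟨ cong (λ z → pos z - pos (x ℕ.* m)) e ⟨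
      pos (gcd m n) + pos (x ℕ.* m) - pos (x ℕ.* m)     ≡⟨ x+y-y (pos (gcd m n)) (pos (x ℕ.* m)) ⟩
      pos (gcd m n) ∎)
    where
    open ≡-Reasoning
    arrange : ∀ m x n y → m * - x + n * y ≡ y * n - x * m
    arrange m x n y = solve (m ∷ x ∷ n ∷ y ∷ [])

  record Bezout (i j : ℤ) (g : ℕ) : Set where
    field
      i′ j′ u v : ℤ
      i≡ : i ≡ pos g * i′
      j≡ : j ≡ pos g * j′
      combination : i * u + j * v ≡ pos g

  bezout : ∀ i j → Bezout i j (gcd ℤ.∣ i ∣ ℤ.∣ j ∣)
  bezout i j with sign-abs i | sign-abs j | bézout-gcd ℤ.∣ i ∣ ℤ.∣ j ∣
                | gcd[m,n]∣m ℤ.∣ i ∣ ℤ.∣ j ∣ | gcd[m,n]∣n ℤ.∣ i ∣ ℤ.∣ j ∣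
  ... | ε , ε²≡1 , i≡ε∣i∣ | η , η²≡1 , j≡η∣j∣ | u , v , e | divides q ∣i∣≡ | divides r ∣j∣≡ = record
    { i′ = ε * pos q
    ; j′ = η * pos r
    ; u = ε * u
    ; v = η * v
    ; i≡ = multiple i ε (gcd ℤ.∣ i ∣ ℤ.∣ j ∣) q i≡ε∣i∣ ∣i∣≡
    ; j≡ = multiple j η (gcd ℤ.∣ i ∣ ℤ.∣ j ∣) r j≡η∣j∣ ∣j∣≡
    ; combination = begin
        i * (ε * u) + j * (η * v)
          ≡⟨ cong₂ (λ x y → x * (ε * u) + y * (η * v)) i≡ε∣i∣ j≡η∣j∣ ⟩
        ε * m * (ε * u) + η * n * (η * v)
          ≡⟨ arrange ε η m n u v ⟩
        (ε * ε) * (m * u) + (η * η) * (n * v)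
          ≡⟨ cong₂ (λ x y → x * (m * u) + y * (n * v)) ε²≡1 η²≡1 ⟩
        1ℤ * (m * u) + 1ℤ * (n * v)
          ≡⟨ cong₂ _+_ (ℤₚ.*-identityˡ (m * u)) (ℤₚ.*-identityˡ (n * v)) ⟩
        m * u + n * v
          ≡⟨ e ⟩
        pos (gcd ℤ.∣ i ∣ ℤ.∣ j ∣) ∎
    }
    where
    open ≡-Reasoning
    m = pos ℤ.∣ i ∣
    n = pos ℤ.∣ j ∣
    arrange : ∀ ε η m n u v → ε * m * (ε * u) + η * n * (η * v) ≡ (ε * ε) * (m * u) + (η * η) * (n * v)
    arrange ε η m n u v = solve (ε ∷ η ∷ m ∷ n ∷ u ∷ v ∷ [])
    multiple : ∀ i ε g q {m} → i ≡ ε * pos m → m ≡ q ℕ.* g → i ≡ pos g * (ε * pos q)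
    multiple i ε g q p refl = trans p (trans (cong (ε *_) (ℤₚ.pos-* q g)) (rotate ε (pos q) (pos g)))
      where
      rotate : ∀ x y z → x * (y * z) ≡ z * (x * y)
      rotate x y z = solve (x ∷ y ∷ z ∷ [])

  -- The first column of the multiplier is the primitive vector annihilated by the bottom row, the
  -- second a Bézout vector for that row. The determinant then forces the corner entry `δ′`.
  triangular : ∀ M₀ δ′ → 0 ℕ.< δ M₀ → det M₀ ≡ pos (δ M₀ ℕ.* δ′) →
    Σ ℤ λ X → InCoset M₀ (mat (pos δ′) X 0ℤ (pos (δ M₀)))
  triangular (mat a b c d) δ′ g>0 det≡ =
    a * u + b * v , mat d′ u (- c′) v , det≡1 , mat-cong corner refl zero≡ combination
    where
    open Bezout (bezout c d) renaming (i′ to c′; j′ to d′; i≡ to c≡; j≡ to d≡)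
    open ≡-Reasoning
    g = gcd ℤ.∣ c ∣ ℤ.∣ d ∣
    instance
      g≢0 : ℤ.NonZero (pos g)
      g≢0 = ℕ.>-nonZero g>0
    det≡1 : d′ * v - u * - c′ ≡ 1ℤ
    det≡1 = ℤₚ.*-cancelˡ-≡ (pos g) _ _ (begin
      pos g * (d′ * v - u * - c′)         ≡⟨ expand (pos g) c′ d′ u v ⟩
      pos g * c′ * u + pos g * d′ * v     ≡⟨ cong₂ (λ x y → x * u + y * v) c≡ d≡ ⟨
      c * u + d * v                       ≡⟨ combination ⟩
      pos g                               ≡⟨ ℤₚ.*-identityʳ (pos g) ⟨
      pos g * 1ℤ ∎)
      where
      expand : ∀ g c′ d′ u v → g * (d′ * v - u * - c′) ≡ g * c′ * u + g * d′ * v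
      expand g c′ d′ u v = solve (g ∷ c′ ∷ d′ ∷ u ∷ v ∷ [])
    corner : a * d′ + b * - c′ ≡ pos δ′
    corner = ℤₚ.*-cancelˡ-≡ (pos g) _ _ (begin
      pos g * (a * d′ + b * - c′)         ≡⟨ expand (pos g) a b c′ d′ ⟩
      a * (pos g * d′) - b * (pos g * c′) ≡⟨ cong₂ (λ x y → a * y - b * x) c≡ d≡ ⟨
      a * d - b * c                       ≡⟨ det≡ ⟩
      pos (g ℕ.* δ′)                      ≡⟨ ℤₚ.pos-* g δ′ ⟩
      pos g * pos δ′ ∎)
      where
      expand : ∀ g a b c′ d′ → g * (a * d′ + b * - c′) ≡ a * (g * d′) - b * (g * c′)
      expand g a b c′ d′ = solve (g ∷ a ∷ b ∷ c′ ∷ d′ ∷ [])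
    zero≡ : c * d′ + d * - c′ ≡ 0ℤ
    zero≡ = trans (cong₂ (λ x y → x * d′ + y * - c′) c≡ d≡) (vanish (pos g) c′ d′)
      where
      vanish : ∀ g c′ d′ → g * c′ * d′ + g * d′ * - c′ ≡ 0ℤ
      vanish g c′ d′ = solve (g ∷ c′ ∷ d′ ∷ [])

  shear : ∀ A X D q → InCoset (mat A X 0ℤ D) (mat A (X + A * q) 0ℤ D)
  shear A X D q = mat 1ℤ q 0ℤ 1ℤ , one q , mat-cong (x*1+y*0 A X) (x*y+z*1 A q X) (x*1+y*0 0ℤ D) (trans (0*x+y q (D * 1ℤ)) (ℤₚ.*-identityʳ D))
    where
    one : ∀ q → 1ℤ * 1ℤ - q * 0ℤ ≡ 1ℤ
    one q = solve (q ∷ [])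

  coset-reduce : ∀ A X D → 0 ℕ.< A →
    Σ ℕ λ β → β ℕ.< A × InCoset (mat (pos A) X 0ℤ D) (mat (pos A) (- pos (β ℕ.+ A)) 0ℤ D)
  coset-reduce A X D A>0 = residue ((- X) %ℕ A) ((- X) /ℕ A) (n%ℕd<d (- X) A) (a≡a%ℕn+[a/ℕn]*n (- X) A)
    where
    instance
      A≢0 : ℕ.NonZero A
      A≢0 = ℕ.>-nonZero A>0
    reduced : ∀ X A β q → - X ≡ β + q * A → X + A * (q - 1ℤ) ≡ - (β + A)
    reduced X A β q p = begin
      X + A * (q - 1ℤ)              ≡⟨ cong (_+ A * (q - 1ℤ)) (ℤₚ.neg-involutive X) ⟨
      - - X + A * (q - 1ℤ)          ≡⟨ cong (λ x → - x + A * (q - 1ℤ)) p ⟩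
      - (β + q * A) + A * (q - 1ℤ)  ≡⟨ arrange β q A ⟩
      - (β + A) ∎
      where
      open ≡-Reasoning
      arrange : ∀ β q A → - (β + q * A) + A * (q - 1ℤ) ≡ - (β + A)
      arrange β q A = solve (β ∷ q ∷ A ∷ [])
    residue : ∀ β q → β ℕ.< A → - X ≡ pos β + q * pos A →
      Σ ℕ λ β → β ℕ.< A × InCoset (mat (pos A) X 0ℤ D) (mat (pos A) (- pos (β ℕ.+ A)) 0ℤ D)
    residue β q β<A p = β , β<A ,
      -- The shift is `q - 1ℤ` and not `q` because `start` lies one step before the reduced residue
      -- and keeps an additional `A`.
      subst (λ Y → InCoset (mat (pos A) X 0ℤ D) (mat (pos A) Y 0ℤ D)) (reduced X (pos A) (pos β) q p)
        (shear (pos A) X D (q - 1ℤ))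

  hermite : ∀ M₀ δ′ → 0 ℕ.< δ M₀ → 0 ℕ.< δ′ → det M₀ ≡ pos (δ M₀ ℕ.* δ′) →
    Σ ℕ λ β → β ℕ.< δ′ × InCoset M₀ (basis (start δ′ β (δ M₀)))
  hermite M₀ δ′ δ>0 δ′>0 det≡ = reduceTo (triangular M₀ δ′ δ>0 det≡)
    where
    reduceTo : (Σ ℤ λ X → InCoset M₀ (mat (pos δ′) X 0ℤ (pos (δ M₀)))) →
      Σ ℕ λ β → β ℕ.< δ′ × InCoset M₀ (basis (start δ′ β (δ M₀)))
    reduceTo (X , h) with coset-reduce δ′ X (pos (δ M₀)) δ′>0
    ... | β , β<δ′ , h′ = β , β<δ′ ,
      coset-trans M₀ (mat (pos δ′) X 0ℤ (pos (δ M₀))) (basis (start δ′ β (δ M₀))) h h′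

  χM-negM : ∀ α β k δ′ → χM (mat α β -[1+ k ] δ′) ≡ χM (negM (mat α β -[1+ k ] δ′))
  χM-negM α β k δ′ = cong χ (cong₂ _,_
    (cong (λ i → i ℚ./ (2 ℕ.* suc k)) (sym (diff-negated α δ′)))
    (cong (λ i → i ℚ./ (4 ℕ.* (suc k ℕ.* suc k))) (invariant α β -[1+ k ] δ′)))
    where
    invariant : ∀ α β γ δ′ → pos 4 * (α * δ′ - β * γ) - (α + δ′) * (α + δ′) ≡
      pos 4 * (- α * - δ′ - - β * - γ) - (- α + - δ′) * (- α + - δ′)
    invariant α β γ δ′ = solve (α ∷ β ∷ γ ∷ δ′ ∷ [])

  coset-negM : ∀ M₀ M → InCoset M₀ M → InCoset M₀ (negM M)
  coset-negM M₀@(mat a b c d) _ (γ@(mat e f g h) , det≡1 , refl) =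
    negM γ , trans (det-neg e f g h) det≡1 , mat-cong (entry a b e g) (entry a b f h) (entry c d e g) (entry c d f h)
    where
    det-neg : ∀ e f g h → - e * - h - - f * - g ≡ e * h - f * g
    det-neg e f g h = solve (e ∷ f ∷ g ∷ h ∷ [])
    entry : ∀ a b e g → a * - e + b * - g ≡ - (a * e + b * g)
    entry a b e g = solve (a ∷ b ∷ e ∷ g ∷ [])

  negM-involutive : ∀ M → negM (negM M) ≡ M
  negM-involutive (mat a b c d) =
    mat-cong (ℤₚ.neg-involutive a) (ℤₚ.neg-involutive b) (ℤₚ.neg-involutive c) (ℤₚ.neg-involutive d)

  χM≢0⇒located : ∀ α β k δ′ → χM (mat α β (pos (suc k)) δ′) ≢ 0ℚ → Located (mat α β (pos (suc k)) δ′)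
  χM≢0⇒located α β k δ′ h with signView β
  -- A positive `β` would make the computed ∣z∣² = - β / c negative, hence below 1.
  ... | positive m = ⊥-elim (h (χ-below {proj₁ (fixPt (mat α (pos (suc m)) (pos (suc k)) δ′))}
                                 (∣z∣²<1 α (pos (suc m)) δ′ k ℤ.-<+)))
  ... | nonpositive B = locate α δ′ B (suc k) (λ z → h (trans (χM-weight α δ′ k B) (cong sixths z)))

  module Enumeration (M₀ : Mat) (e β D : ℕ) (e>0 : 0 ℕ.< e) (D>0 : 0 ℕ.< D)
                     (coset : InCoset M₀ (basis (start (e ℕ.+ β) β D))) where
    A = e ℕ.+ β
    s₀ s₁ s₂ : State
    s₀ = start A β D
    s₁ = next s₀
    s₂ = next s₁

    -- `s₂` has width `e + β = A`, so one more than `2 * A` meets the bound of `Φ-iterate-vanishes`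
    -- whatever the height is.
    fuel : ℕ
    fuel = suc (2 ℕ.* A)

    entries : List (ℕ × Mat)
    entries = trail (2 ℕ.+ fuel) s₀

    matrices : List Mat
    matrices = support entries

    β<A : β ℕ.< A
    β<A = ℕₚ.+-monoˡ-≤ β e>0

    s₁≡ : s₁ ≡ ⟨ A , β , 0 , D ⟩
    s₁≡ = next-left {A} {β} {0} {D}

    s₂≡ : s₂ ≡ ⟨ e , β , D , D ⟩
    s₂≡ = trans (cong next s₁≡) (next-right {e} {β} {0} {D} e>0)

    s₀-valid : Valid s₀
    s₀-valid = ℕₚ.m≤n⇒m≤n+o β e>0 , D>0

    s₂-positive : Positive s₂
    s₂-positive = subst Positive (sym s₂≡) (D>0 , D>0)

    Φ-end : Φ (iterate fuel s₂) ≡ 0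
    Φ-end = Φ-iterate-vanishes fuel s₂ s₂-positive
      (subst (λ s → 2 ℕ.* width s ℕ.< height s ℕ.+ fuel) (sym s₂≡) (ℕₚ.m≤n+m (suc (2 ℕ.* A)) (D ℕ.+ D)))

    entries-weight : totalWeight entries ≡ startWeight e β D
    entries-weight = begin
      totalWeight entries
        ≡⟨ totalWeight-++ (items s₀) (items s₁ ++ trail fuel s₂) ⟩
      totalWeight (items s₀) ℕ.+ totalWeight (items s₁ ++ trail fuel s₂)
        ≡⟨ cong (totalWeight (items s₀) ℕ.+_) (totalWeight-++ (items s₁) (trail fuel s₂)) ⟩
      totalWeight (items s₀) ℕ.+ (totalWeight (items s₁) ℕ.+ totalWeight (trail fuel s₂))
        ≡⟨ cong₂ ℕ._+_ (items-left A β 0 D) (cong₂ ℕ._+_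
             (trans (cong (totalWeight ∘ items) s₁≡) (items-right e β 0 D e>0)) tail-weight) ⟩
      startWeight e β D ∎
      where
      open ≡-Reasoning
      tail-weight : totalWeight (trail fuel s₂) ≡ potential e β D D
      tail-weight = trans (sym (ℕₚ.+-identityʳ (totalWeight (trail fuel s₂)))) (trans (cong (totalWeight (trail fuel s₂) ℕ.+_) (sym Φ-end))
        (trans (trail-weight fuel s₂ s₂-positive) (cong Φ s₂≡)))

    matrices-sum : sumℚ (map χM matrices) ≡ sixths (startWeight e β D)
    matrices-sum = trans (support-sum {entries} (trail-weighted (2 ℕ.+ fuel) s₀)) (cong sixths entries-weight)

    matrices-elliptic : All (λ M → InCoset M₀ M × Elliptic M) matrices
    matrices-elliptic = support-All (All.zipWith (λ (w , h) k≢0 → h , weighted-elliptic w k≢0)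
      (trail-weighted (2 ℕ.+ fuel) s₀ , trail-coset M₀ (2 ℕ.+ fuel) s₀ coset))

    matrices-distinct : AllPairs (λ M N → ¬ (M ≈± N)) matrices
    matrices-distinct = support-distinct (trail-weighted (2 ℕ.+ fuel) s₀) (trail-distinct (2 ℕ.+ fuel) s₀ s₀-valid)

    ∈-entries : ∀ k {p} → p ∈ items (iterate k s₀) → proj₁ p ≢ 0 → p ∈ entries
    ∈-entries 0 h _ = ∈-++⁺ˡ h
    ∈-entries 1 h _ = ∈-++⁺ʳ (items s₀) (∈-++⁺ˡ h)
    ∈-entries (suc (suc k)) h p≢0 =
      ∈-++⁺ʳ (items s₀) (∈-++⁺ʳ (items s₁) (∈-trail fuel k s₂ s₂-positive Φ-end h p≢0))

    located-∈ : ∀ {M} → InCoset M₀ M → Located M → M ∈ matrices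
    located-∈ {M} M∈ (s , v , k , h , k≢0) = support-∈ (entry (reach D>0 β<A (height s) s v ℕₚ.≤-refl s∈)) k≢0
      where
      s∈ : InCoset (basis s₀) (basis s)
      s∈ = coset-trans (basis s₀) M₀ (basis s) (coset-sym M₀ (basis s₀) coset)
        (coset-trans M₀ M (basis s) M∈ (coset-sym (basis s) M (All.lookup (items-coset s) h)))
      entry : (∃ λ j → s ≡ iterate j s₀) ⊎ Shore s → (k , M) ∈ entries
      entry (inj₁ (j , refl)) = ∈-entries j h k≢0
      entry (inj₂ sh) = ⊥-elim (k≢0 (weightless (items s) (shore-weightless s v sh) h))

    matrices-complete : ∀ M → InCoset M₀ M → χM M ≢ 0ℚ → Any (M ≈±_) matrices
    -- For `c = 0` the default point (0, 0) lies below the unit circle, so `χM` evaluates to 0.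
    matrices-complete (mat α b (pos zero) d) _ χ≢0 = ⊥-elim (χ≢0 refl)
    matrices-complete (mat α b (pos (suc k)) d) h χ≢0 =
      Any.map inj₁ (located-∈ h (χM≢0⇒located α b k d χ≢0))
    -- The listed matrices all have `c > 0`, so here the negative of `M` is the one found.
    matrices-complete M@(mat α b -[1+ k ] d) h χ≢0 =
      Any.map (λ p → inj₂ (trans (sym (negM-involutive M)) (cong negM p)))
        (located-∈ (coset-negM M₀ M h)
          (χM≢0⇒located (- α) (- b) k (- d) (λ z → χ≢0 (trans (χM-negM α b k d) z))))

  -- A scalar matrix s and the start are both upper triangular, so `upper` gives `δ′ = D = s` and
  -- makes `β + s` a multiple of s; `β < s` leaves only `β = 0`.
  root⇒ : ∀ n M₀ {δ′ β D} → 1 ℕ.≤ n → 0 ℕ.< D → β ℕ.< δ′ → InCoset M₀ (basis (start δ′ β D)) →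
    IsRootCoset n M₀ → δ′ ≡ D × β ≡ 0
  root⇒ n M₀ {δ′} {β} {D} n≥1 D>0 β<δ′ h (zero , refl , _) = ⊥-elim (ℕₚ.<-irrefl refl n≥1)
  root⇒ n M₀ {δ′} {β} {D} n≥1 D>0 β<δ′ h (s@(suc _) , _ , h′)
    with upper {s} {s} {δ′} {D} {0ℤ} { - pos (β ℕ.+ δ′)} z<s D>0
           (coset-trans (scalar (pos s)) M₀ (basis (start δ′ β D)) h′ h)
  ... | refl , refl , q , e = refl , β≡0 ℤ.∣ q ∣ abs≡
    where
    abs≡ : β ℕ.+ s ≡ s ℕ.* ℤ.∣ q ∣
    abs≡ = trans (sym (∣-pos∣ (β ℕ.+ s))) (trans (cong ℤ.∣_∣ (trans e (ℤₚ.+-identityˡ (pos s * q)))) (ℤₚ.abs-* (pos s) q))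
    β≡0 : ∀ r → β ℕ.+ s ≡ s ℕ.* r → β ≡ 0
    β≡0 0 p = ℕₚ.m+n≡0⇒m≡0 β (trans p (ℕₚ.*-zeroʳ s))
    β≡0 1 p = ℕₚ.+-cancelʳ-≡ s β 0 (trans p (ℕₚ.*-identityʳ s))
    β≡0 (suc (suc r)) p = ⊥-elim (contra s β r β<δ′ p)
      where
      contra : ∀ s β r → β ℕ.< s → β ℕ.+ s ≡ s ℕ.* suc (suc r) → ⊥
      contra s β r β<s p = ℕₚ.<-irrefl {0} refl (lin (s ℕ.* r) (β<s ⊕ ℕₚ.≤-reflexive (sym p)) (solveℕ (s ∷ β ∷ r ∷ [])))

  ⇒root : ∀ n M₀ D → D ℕ.* D ≡ n → InCoset M₀ (basis (start D 0 D)) → IsRootCoset n M₀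
  ⇒root n M₀ D D²≡n h = D , D²≡n , coset-trans (scalar (pos D)) (basis (start D 0 D)) M₀
    (subst (λ Y → InCoset (scalar (pos D)) (mat (pos D) Y 0ℤ (pos D))) (sheared (pos D)) (shear (pos D) 0ℤ (pos D) -1ℤ))
    (coset-sym M₀ (basis (start D 0 D)) h)
    where
    sheared : ∀ x → 0ℤ + x * -1ℤ ≡ - x
    sheared x = solve (x ∷ [])

  sgnDiff-< : ∀ {x y} → x ℕ.< y → sgnDiff x y ≡ ℚ.- 1ℚ
  sgnDiff-< {x} {y} p rewrite dec-true (x ℕ.<? y) p = refl

  sgnDiff-> : ∀ {x y} → y ℕ.< x → sgnDiff x y ≡ 1ℚ
  sgnDiff-> {x} {y} p rewrite dec-false (x ℕ.<? y) (ℕₚ.<-asym p) | dec-true (y ℕ.<? x) p = refl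

  sgnDiff-refl : ∀ x → sgnDiff x x ≡ 0ℚ
  sgnDiff-refl x rewrite dec-false (x ℕ.<? x) (ℕₚ.<-irrefl refl) = refl

  SumFormula : ℕ → Mat → ℕ → ℕ → ℚ → Set
  SumFormula n M₀ δ′ D q =
    (IsRootCoset n M₀ → q ≡ 1ℚ ℚ.+ sgnDiff δ′ D ℚ.+ sixth) ×
    (¬ IsRootCoset n M₀ → q ≡ 1ℚ ℚ.+ sgnDiff δ′ D)

  -- The weight is a variable equated with 7 so that after matching the rational identity 7/6 = 1 +
  -- 0 + 1/6 holds by evaluation.
  formula-root : ∀ n M₀ D w → w ≡ 7 → IsRootCoset n M₀ → SumFormula n M₀ D D (sixths w)
  formula-root n M₀ D _ refl r =
    (λ _ → cong (λ x → 1ℚ ℚ.+ x ℚ.+ sixth) (sym (sgnDiff-refl D))) , λ ¬r → ⊥-elim (¬r r)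

  formula-other : ∀ n M₀ δ′ D w x → sixths w ≡ 1ℚ ℚ.+ x → sgnDiff δ′ D ≡ x → ¬ IsRootCoset n M₀ →
    SumFormula n M₀ δ′ D (sixths w)
  formula-other n M₀ δ′ D _ _ p q ¬r = (λ r → ⊥-elim (¬r r)) , λ _ → trans p (cong (1ℚ ℚ.+_) (sym q))

  startWeight-formula : ∀ n M₀ e β D → 1 ℕ.≤ n → 0 ℕ.< e → 0 ℕ.< D → D ℕ.* (e ℕ.+ β) ≡ n →
    InCoset M₀ (basis (start (e ℕ.+ β) β D)) → SumFormula n M₀ (e ℕ.+ β) D (sixths (startWeight e β D))
  startWeight-formula n M₀ e β D n≥1 e>0 D>0 DA≡n h = compare (ℕₚ.<-cmp (e ℕ.+ β) D)
    where
    root : IsRootCoset n M₀ → e ℕ.+ β ≡ D × β ≡ 0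
    root = root⇒ n M₀ n≥1 D>0 (ℕₚ.+-monoˡ-≤ β e>0) h
    -- `β` and `D` are generalised so that the equality of the two divisors can be matched and
    -- `β = 0`, the root coset, split off.
    square : ∀ β D → e ℕ.+ β ≡ D → 0 ℕ.< D → D ℕ.* (e ℕ.+ β) ≡ n → InCoset M₀ (basis (start (e ℕ.+ β) β D)) →
      (IsRootCoset n M₀ → β ≡ 0) → SumFormula n M₀ (e ℕ.+ β) D (sixths (startWeight e β D))
    square zero D refl D>0 DA≡n h _ = formula-root n M₀ D (startWeight e 0 D)
      (trans (cong (startWeight e 0) (ℕₚ.+-identityʳ e)) (startWeight-≡0 e e>0)) (⇒root n M₀ D DA≡n h)
    square β@(suc _) D refl D>0 DA≡n h β≡0 = formula-other n M₀ D D (startWeight e β D) 0ℚ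
      (cong sixths (startWeight-≡ e β D e>0 z<s refl)) (sgnDiff-refl D) (ℕₚ.1+n≢0 ∘ β≡0)
    compare : Tri (e ℕ.+ β ℕ.< D) (e ℕ.+ β ≡ D) (D ℕ.< e ℕ.+ β) →
      SumFormula n M₀ (e ℕ.+ β) D (sixths (startWeight e β D))
    compare (tri< p p≢ _) = formula-other n M₀ (e ℕ.+ β) D (startWeight e β D) (ℚ.- 1ℚ)
      (cong sixths (startWeight-< e β D D>0 p)) (sgnDiff-< p) (p≢ ∘ proj₁ ∘ root)
    compare (tri> _ p≢ p) = formula-other n M₀ (e ℕ.+ β) D (startWeight e β D) 1ℚ
      (cong sixths (startWeight-> e β D e>0 D>0 p)) (sgnDiff-> p) (p≢ ∘ proj₁ ∘ root)
    compare (tri≈ _ p _) = square β D p D>0 DA≡n h (proj₂ ∘ root)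

  factor>0 : ∀ {m k n} → 1 ℕ.≤ n → m ℕ.* k ≡ n → 0 ℕ.< m × 0 ℕ.< k
  factor>0 {zero} n≥1 refl = ⊥-elim (ℕₚ.<-irrefl refl n≥1)
  factor>0 {suc m} {zero} n≥1 refl = ⊥-elim (ℕₚ.<-irrefl (sym (ℕₚ.*-zeroʳ m)) n≥1)
  factor>0 {suc m} {suc k} _ _ = z<s , z<s

  Enumerated : ℕ → Mat → ℕ → ℕ → Set
  Enumerated n M₀ δ′ D = Σ (List Mat) λ L →
    All (λ M → InCoset M₀ M × Elliptic M) L ×
    AllPairs (λ M N → ¬ (M ≈± N)) L ×
    ((M : Mat) → InCoset M₀ M → Elliptic M → χM M ≢ 0ℚ → Any (λ N → M ≈± N) L) ×
    SumFormula n M₀ δ′ D (sumℚ (map χM L))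

  enumerate : ∀ n M₀ δ′ D β → 1 ℕ.≤ n → 0 ℕ.< D → D ℕ.* δ′ ≡ n → β ℕ.< δ′ →
    InCoset M₀ (basis (start δ′ β D)) → Enumerated n M₀ δ′ D
  enumerate n M₀ δ′ D β n≥1 D>0 Dδ′≡n β<δ′ h =
    go (δ′ ℕ.∸ β) (ℕₚ.m<n⇒0<n∸m β<δ′) (ℕₚ.m∸n+n≡m (ℕₚ.<⇒≤ β<δ′))
    where
    go : ∀ e → 0 ℕ.< e → e ℕ.+ β ≡ δ′ → Enumerated n M₀ δ′ D
    go e e>0 refl =
      matrices , matrices-elliptic , matrices-distinct , (λ M M∈ _ → matrices-complete M M∈) ,
      subst (SumFormula n M₀ (e ℕ.+ β) D) (sym matrices-sum) (startWeight-formula n M₀ e β D n≥1 e>0 D>0 Dδ′≡n h)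
      where open Enumeration M₀ e β D e>0 D>0 h

open import Defs
open import Data.Nat using (ℕ; _≤_; _*_)
open import Data.Integer using (+_)
open import Data.Rational using (ℚ; 1ℚ; 0ℚ; _+_)
open import Data.Product using (Σ; _×_; proj₁; proj₂)
open import Data.List using (List; map)
open import Data.List.Relation.Unary.All using (All)
open import Data.List.Relation.Unary.Any using (Any)
open import Data.List.Relation.Unary.AllPairs using (AllPairs)
open import Relation.Nullary using (¬_)
open import Relation.Binary.PropositionalEquality using (_≡_; _≢_; trans; sym; cong)
open Assembly using (enumerate; hermite; factor>0)

theorem2 : (n : ℕ) → 1 ≤ n → (M₀ : Mat) → det M₀ ≡ + n →
    (δ' : ℕ) → δ M₀ * δ' ≡ n →
    Σ (List Mat) (λ L →
    All (λ M → InCoset M₀ M × Elliptic M) L ×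
    AllPairs (λ M N → ¬ (M ≈± N)) L ×
    ((M : Mat) → InCoset M₀ M → Elliptic M → χM M ≢ 0ℚ → Any (λ N → M ≈± N) L) ×
    (IsRootCoset n M₀ → sumℚ (map χM L) ≡ 1ℚ + sgnDiff δ' (δ M₀) + sixth) ×
    (¬ IsRootCoset n M₀ → sumℚ (map χM L) ≡ 1ℚ + sgnDiff δ' (δ M₀)))
theorem2 n n≥1 M₀ det≡n δ' δδ'≡n =
  enumerate n M₀ δ' (δ M₀) (proj₁ normal) n≥1 δ>0 δδ'≡n (proj₁ (proj₂ normal)) (proj₂ (proj₂ normal))
  where
  δ>0 = proj₁ (factor>0 n≥1 δδ'≡n)
  normal = hermite M₀ δ' δ>0 (proj₂ (factor>0 {δ M₀} n≥1 δδ'≡n)) (trans det≡n (cong +_ (sym δδ'≡n)))
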